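{- Let $S=\langle m,n_2,\ldots,n_k\rangle$ be a numerical semigroup contained in the face $F\subset\mathcal{C}(\mathbb{Z}_m)$, and let $T=\langle\alpha\rangle+\beta S$ be a monoscopic gluing of $S$ contained in the face $F'\subset\mathcal{C}(\mathbb{Z}_{\beta m})$. Then $$\dim F'=\begin{cases}\dim F&\text{if }\alpha\in\operatorname{Ap}(S;m);\\ \dim F+1&\text{if }\alpha\notin\operatorname{Ap}(S;m).\end{cases}$$
   Context: A numerical semigroup is a subset $S \subseteq \mathbb{Z}_{\ge 0}$ containing $0$, closed under addition, with finite complement; $\langle n_1,\ldots,n_k\rangle$ denotes the set of all non-negative integer combinations of $n_1,\ldots,n_k$. For $m \in S$, $m>0$, the Apéry set $\operatorname{Ap}(S;m) = \{n \in S : n-m\notin S\}$ has exactly one element in each residue class modulo $m$; writing $\operatorname{Ap}(S;m) = \{0,a_1,\ldots,a_{m-1}\}$ with $a_i\equiv i \bmod m$, the Apéry tuple of $S$ (with respect to $m$) is $(a_1,\ldots,a_{m-1})$. For a positive integer $m$, the group cone $\mathcal{C}(\mathbb{Z}_m)\subset\mathbb{R}^{m-1}$ (coordinates indexed by $\mathbb{Z}_m\setminus\{0\}$) is the cone defined by the inequalities $x_i+x_j\ge x_{i+j}$ for $i,j\in\mathbb{Z}_m\setminus\{0\}$ with $i+j\ne 0$. A face $F$ of $\mathcal{C}(\mathbb{Z}_m)$ contains a numerical semigroup $S$ (with $m\in S$) if the Apéry tuple of $S$ with respect to $m$ lies in the relative interior of $F$. The dimension of a face is the dimension of its affine span. Monoscopic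 gluing: given a numerical semigroup $S=\langle n_1,\ldots,n_k\rangle$, an integer $\beta\ge 2$, and an element $\alpha\in S\setminus\{n_1,\ldots,n_k\}$ with $\gcd(\alpha,\beta)=1$, the numerical semigroup $T=\langle\alpha\rangle+\beta S=\langle\alpha,\beta n_1,\ldots,\beta n_k\rangle$ is called a monoscopic gluing of $S$ (here $n_1=m$). -}

module Defs where

open import Algebra.Bundles using (RawMonoid)
import Algebra.Definitions.RawMonoid as Sum
open import Data.Fin using (Fin; toℕ)
open import Data.Integer using (+_)
open import Data.Nat as ℕ using (ℕ; suc)
import Data.Nat.Divisibility as ℕ
import Data.Nat.Properties as ℕ
open import Data.Product using (∃-syntax; Σ-syntax; _×_; _,_)
open import Data.Rational as ℚ using (ℚ; 0ℚ; 1ℚ)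
import Data.Rational.Properties as ℚ
open import Data.Rational.Solver using (module +-*-Solver)
open import Data.Vec.Functional using (Vector)
open import Function.Bundles using (_⇔_)
open import Level using (0ℓ)
open import Relation.Binary.Core using (Rel)
open import Relation.Binary.PropositionalEquality
open import Relation.Nullary using (¬_)
open import Relation.Unary using (Pred; _∈_)

-- The real numbers: Cauchy sequences of rationals, with the setoid equality
-- "the difference tends to 0".  The order and the operations are opaque only
-- because unfolding rational arithmetic makes type checking intractable.
module Real where

  Cauchy : (ℕ → ℚ) → Set
  Cauchy x = ∀ ε → 0ℚ ℚ.< ε →
    ∃[ N ] (∀ i j → N ℕ.≤ i → N ℕ.≤ j → ℚ.∣ x i ℚ.- x j ∣ ℚ.< ε)

  record ℝ : Set where
    constructor mkℝ
    field
      seq    : ℕ → ℚ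
      cauchy : Cauchy seq

  open ℝ public

  infix 4 _≈_ _≤_ _<_

  opaque

    _≈_ : Rel ℝ 0ℓ
    x ≈ y = ∀ ε → 0ℚ ℚ.< ε →
      ∃[ N ] (∀ i → N ℕ.≤ i → ℚ.∣ seq x i ℚ.- seq y i ∣ ℚ.< ε)

    _≤_ : Rel ℝ 0ℓ
    x ≤ y = ∀ ε → 0ℚ ℚ.< ε →
      ∃[ N ] (∀ i → N ℕ.≤ i → seq x i ℚ.< seq y i ℚ.+ ε)

    _<_ : Rel ℝ 0ℓ
    x < y = ∃[ ε ] (0ℚ ℚ.< ε ×
      ∃[ N ] (∀ i → N ℕ.≤ i → seq x i ℚ.+ ε ℚ.< seq y i))

  private
    open ℚ.≤-Reasoning

    half : ∀ ε → 0ℚ ℚ.< ε → 0ℚ ℚ.< ℚ.½ ℚ.* ε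
    half ε 0<ε = ℚ.*-monoʳ-<-pos ℚ.½ 0<ε

    halves : ∀ ε → ℚ.½ ℚ.* ε ℚ.+ ℚ.½ ℚ.* ε ≡ ε
    halves ε = trans (sym (ℚ.*-distribʳ-+ ε ℚ.½ ℚ.½)) (ℚ.*-identityˡ ε)

    cauchy-const : ∀ q → Cauchy (λ _ → q)
    cauchy-const q ε 0<ε = 0 , λ _ _ _ _ →
      subst (ℚ._< ε) (sym (cong ℚ.∣_∣ (ℚ.+-inverseʳ q))) 0<ε

    cauchy-+ : ∀ {x y} → Cauchy x → Cauchy y → Cauchy (λ i → x i ℚ.+ y i)
    cauchy-+ {x} {y} cx cy ε 0<ε
      with cx (ℚ.½ ℚ.* ε) (half ε 0<ε) | cy (ℚ.½ ℚ.* ε) (half ε 0<ε)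
    ... | M , p | N , q = M ℕ.⊔ N , λ i j h k → begin-strict
      ℚ.∣ (x i ℚ.+ y i) ℚ.- (x j ℚ.+ y j) ∣
        ≡⟨ cong ℚ.∣_∣ (rearrange (x i) (y i) (x j) (y j)) ⟩
      ℚ.∣ (x i ℚ.- x j) ℚ.+ (y i ℚ.- y j) ∣
        ≤⟨ ℚ.∣p+q∣≤∣p∣+∣q∣ (x i ℚ.- x j) (y i ℚ.- y j) ⟩
      ℚ.∣ x i ℚ.- x j ∣ ℚ.+ ℚ.∣ y i ℚ.- y j ∣
        <⟨ ℚ.+-mono-< (p i j (ℕ.m⊔n≤o⇒m≤o M N h) (ℕ.m⊔n≤o⇒m≤o M N k))
                      (q i j (ℕ.m⊔n≤o⇒n≤o M N h) (ℕ.m⊔n≤o⇒n≤o M N k)) ⟩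
      ℚ.½ ℚ.* ε ℚ.+ ℚ.½ ℚ.* ε
        ≡⟨ halves ε ⟩
      ε ∎
      where
      open +-*-Solver
      rearrange : ∀ a b c d →
        (a ℚ.+ b) ℚ.- (c ℚ.+ d) ≡ (a ℚ.- c) ℚ.+ (b ℚ.- d)
      rearrange = solve 4
        (λ a b c d → (a :+ b) :- (c :+ d) := (a :- c) :+ (b :- d)) refl

    cauchy-neg : ∀ {x} → Cauchy x → Cauchy (λ i → ℚ.- x i)
    cauchy-neg {x} cx ε 0<ε with cx ε 0<ε
    ... | N , p = N , λ i j h k → subst (ℚ._< ε)
      (trans (sym (ℚ.∣-p∣≡∣p∣ (x i ℚ.- x j)))
             (cong ℚ.∣_∣ (ℚ.neg-distrib-+ (x i) (ℚ.- x j))))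
      (p i j h k)

    eventually-bounded : ∀ {x} → Cauchy x →
      ∃[ B ] (ℚ.Positive B × ∃[ N ] (∀ i → N ℕ.≤ i → ℚ.∣ x i ∣ ℚ.≤ B))
    eventually-bounded {x} cx with cx 1ℚ (ℚ.positive⁻¹ 1ℚ)
    ... | N , p = 1ℚ ℚ.+ ℚ.∣ x N ∣
      , ℚ.pos+nonNeg⇒pos 1ℚ ℚ.∣ x N ∣ {{ℚ.∣-∣-nonNeg (x N)}}
      , N , λ i h → begin
        ℚ.∣ x i ∣
          ≡⟨ cong ℚ.∣_∣ (split (x i) (x N)) ⟩
        ℚ.∣ (x i ℚ.- x N) ℚ.+ x N ∣
          ≤⟨ ℚ.∣p+q∣≤∣p∣+∣q∣ (x i ℚ.- x N) (x N) ⟩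
        ℚ.∣ x i ℚ.- x N ∣ ℚ.+ ℚ.∣ x N ∣
          ≤⟨ ℚ.+-monoˡ-≤ ℚ.∣ x N ∣ (ℚ.<⇒≤ (p i N h ℕ.≤-refl)) ⟩
        1ℚ ℚ.+ ℚ.∣ x N ∣ ∎
      where
      open +-*-Solver
      split : ∀ a b → a ≡ (a ℚ.- b) ℚ.+ b
      split = solve 2 (λ a b → a := (a :- b) :+ b) refl

    scale : ∀ B → .{{ℚ.Positive B}} → ∀ ε → 0ℚ ℚ.< ε →
      ∃[ δ ] (0ℚ ℚ.< δ × B ℚ.* δ ≡ ε)
    scale B ε 0<ε =
        r ℚ.* ε
      , subst (ℚ._< r ℚ.* ε) (ℚ.*-zeroʳ r)
          (ℚ.*-monoʳ-<-pos r {{ℚ.1/pos⇒pos B}} 0<ε)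
      , trans (sym (ℚ.*-assoc B r ε))
          (trans (cong (ℚ._* ε) (ℚ.*-inverseʳ B {{ℚ.pos⇒nonZero B}}))
                 (ℚ.*-identityˡ ε))
      where
      r : ℚ
      r = (ℚ.1/ B) {{ℚ.pos⇒nonZero B}}

    scaled-close : ∀ B → .{{ℚ.Positive B}} → ∀ {a b δ η} → B ℚ.* δ ≡ η →
      ℚ.∣ a ∣ ℚ.≤ B → ℚ.∣ b ∣ ℚ.< δ → ℚ.∣ a ℚ.* b ∣ ℚ.< η
    scaled-close B {a} {b} {δ} {η} eq a≤B b<δ = begin-strict
      ℚ.∣ a ℚ.* b ∣        ≡⟨ ℚ.∣p*q∣≡∣p∣*∣q∣ a b ⟩
      ℚ.∣ a ∣ ℚ.* ℚ.∣ b ∣  ≤⟨ ℚ.*-monoʳ-≤-nonNeg ℚ.∣ b ∣ {{ℚ.∣-∣-nonNeg b}} a≤B ⟩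
      B ℚ.* ℚ.∣ b ∣        <⟨ ℚ.*-monoʳ-<-pos B b<δ ⟩
      B ℚ.* δ              ≡⟨ eq ⟩
      η                    ∎

    product-close : ∀ A B → ℚ.Positive A → ℚ.Positive B → ∀ {ε δ γ a b c d} →
      A ℚ.* δ ≡ ℚ.½ ℚ.* ε → B ℚ.* γ ≡ ℚ.½ ℚ.* ε →
      ℚ.∣ a ∣ ℚ.≤ A → ℚ.∣ d ∣ ℚ.≤ B →
      ℚ.∣ b ℚ.- d ∣ ℚ.< δ → ℚ.∣ a ℚ.- c ∣ ℚ.< γ →
      ℚ.∣ a ℚ.* b ℚ.- c ℚ.* d ∣ ℚ.< ε
    product-close A B A>0 B>0 {ε} {δ} {γ} {a} {b} {c} {d} Aδ Bγ a≤A d≤B b-d a-c =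
      begin-strict
      ℚ.∣ a ℚ.* b ℚ.- c ℚ.* d ∣
        ≡⟨ cong ℚ.∣_∣ (rearrange a b c d) ⟩
      ℚ.∣ a ℚ.* (b ℚ.- d) ℚ.+ d ℚ.* (a ℚ.- c) ∣
        ≤⟨ ℚ.∣p+q∣≤∣p∣+∣q∣ (a ℚ.* (b ℚ.- d)) (d ℚ.* (a ℚ.- c)) ⟩
      ℚ.∣ a ℚ.* (b ℚ.- d) ∣ ℚ.+ ℚ.∣ d ℚ.* (a ℚ.- c) ∣
        <⟨ ℚ.+-mono-< (scaled-close A {{A>0}} {a} {b ℚ.- d} Aδ a≤A b-d)
                      (scaled-close B {{B>0}} {d} {a ℚ.- c} Bγ d≤B a-c) ⟩
      ℚ.½ ℚ.* ε ℚ.+ ℚ.½ ℚ.* ε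
        ≡⟨ halves ε ⟩
      ε ∎
      where
      open +-*-Solver
      rearrange : ∀ a b c d →
        a ℚ.* b ℚ.- c ℚ.* d ≡ a ℚ.* (b ℚ.- d) ℚ.+ d ℚ.* (a ℚ.- c)
      rearrange = solve 4
        (λ a b c d → a :* b :- c :* d := a :* (b :- d) :+ d :* (a :- c)) refl

    cauchy-* : ∀ {x y} → Cauchy x → Cauchy y → Cauchy (λ i → x i ℚ.* y i)
    cauchy-* {x} {y} cx cy ε 0<ε =
      let A , A>0 , K , x≤A = eventually-bounded cx
          B , B>0 , L , y≤B = eventually-bounded cy
          δ , 0<δ , Aδ = scale A {{A>0}} (ℚ.½ ℚ.* ε) (half ε 0<ε)
          γ , 0<γ , Bγ = scale B {{B>0}} (ℚ.½ ℚ.* ε) (half ε 0<ε)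
          M , p = cx γ 0<γ
          N , q = cy δ 0<δ
      in (K ℕ.⊔ L) ℕ.⊔ (M ℕ.⊔ N) , λ i j h k →
        let KL≤i = ℕ.m⊔n≤o⇒m≤o (K ℕ.⊔ L) (M ℕ.⊔ N) h
            KL≤j = ℕ.m⊔n≤o⇒m≤o (K ℕ.⊔ L) (M ℕ.⊔ N) k
            MN≤i = ℕ.m⊔n≤o⇒n≤o (K ℕ.⊔ L) (M ℕ.⊔ N) h
            MN≤j = ℕ.m⊔n≤o⇒n≤o (K ℕ.⊔ L) (M ℕ.⊔ N) k
        in product-close A B A>0 B>0 {ε} {δ} {γ} {x i} {y i} {x j} {y j} Aδ Bγ
             (x≤A i (ℕ.m⊔n≤o⇒m≤o K L KL≤i))
             (y≤B j (ℕ.m⊔n≤o⇒n≤o K L KL≤j))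
             (q i j (ℕ.m⊔n≤o⇒n≤o M N MN≤i) (ℕ.m⊔n≤o⇒n≤o M N MN≤j))
             (p i j (ℕ.m⊔n≤o⇒m≤o M N MN≤i) (ℕ.m⊔n≤o⇒m≤o M N MN≤j))

  infixl 6 _+_ _-_
  infixl 7 _*_
  infix  8 -_

  opaque

    fromℚ : ℚ → ℝ
    fromℚ q = mkℝ (λ _ → q) (cauchy-const q)

    _+_ : ℝ → ℝ → ℝ
    x + y = mkℝ (λ i → seq x i ℚ.+ seq y i)
                (cauchy-+ {seq x} {seq y} (cauchy x) (cauchy y))

    _*_ : ℝ → ℝ → ℝ
    x * y = mkℝ (λ i → seq x i ℚ.* seq y i)
                (cauchy-* {seq x} {seq y} (cauchy x) (cauchy y))

    -_ : ℝ → ℝ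
    - x = mkℝ (λ i → ℚ.- seq x i) (cauchy-neg {seq x} (cauchy x))

  _-_ : ℝ → ℝ → ℝ
  x - y = x + (- y)

  fromℕ : ℕ → ℝ
  fromℕ n = fromℚ (+ n ℚ./ 1)

  0# 1# : ℝ
  0# = fromℕ 0
  1# = fromℕ 1

  ∑ : ∀ {n} → Vector ℝ n → ℝ
  ∑ = Sum.sum (record { Carrier = ℝ ; _≈_ = _≈_ ; _∙_ = _+_ ; ε = 0# })

open Real using (ℝ; _≈_; _+_; _-_; _*_; _≤_; _<_; 0#; 1#; fromℕ; ∑)

infix 4 _≋_

_≋_ : ∀ {n} → Rel (Vector ℝ n) 0ℓ
x ≋ y = ∀ i → x i ≈ y i

combination : ∀ {k n} → Vector ℝ k → Vector (Vector ℝ n) k → Vector ℝ n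
combination c v i = ∑ (λ j → c j * v j i)

AffineSpan : ∀ {n} → Pred (Vector ℝ n) 0ℓ → Pred (Vector ℝ n) 0ℓ
AffineSpan {n} X x =
  Σ[ k ∈ ℕ ] Σ[ v ∈ Vector (Vector ℝ n) k ] Σ[ c ∈ Vector ℝ k ]
    ((∀ j → v j ∈ X) × ∑ c ≈ 1# × x ≋ combination c v)

AffinelyIndependent : ∀ {k n} → Vector (Vector ℝ n) k → Set
AffinelyIndependent {k} v =
  (c : Vector ℝ k) → ∑ c ≈ 0# → combination c v ≋ (λ _ → 0#) → ∀ j → c j ≈ 0#

record AffineBasis {k n} (A : Pred (Vector ℝ n) 0ℓ)
                   (v : Vector (Vector ℝ n) k) : Set where
  field
    members     : ∀ j → v j ∈ A
    independent : AffinelyIndependent v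
    spanning    : ∀ x → x ∈ A →
                  Σ[ c ∈ Vector ℝ k ] (∑ c ≈ 1# × x ≋ combination c v)

-- dim X = d, where dim X is the dimension of the affine span of X.
HasDim : ∀ {n} → Pred (Vector ℝ n) 0ℓ → ℕ → Set
HasDim {n} X d =
  Σ[ v ∈ Vector (Vector ℝ n) (suc d) ] AffineBasis (AffineSpan X) v

-- Interior relative to the affine span; balls are taken in the sup norm.
RelativeInterior : ∀ {n} → Pred (Vector ℝ n) 0ℓ → Pred (Vector ℝ n) 0ℓ
RelativeInterior {n} X x =
  x ∈ X ×
  Σ[ ε ∈ ℝ ] (0# < ε ×
    ((y : Vector ℝ n) → y ∈ AffineSpan X →
      (∀ i → x i - ε < y i × y i < x i + ε) → y ∈ X))

-- The nonzero residues modulo m are 1, …, m - 1; the coordinate with index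
-- i : Fin (m - 1) belongs to the residue 1 + i.
Index : ℕ → Set
Index m = Fin (ℕ.pred m)

residue : ∀ {n} → Fin n → ℕ
residue i = suc (toℕ i)

Point : ℕ → Set
Point m = Vector ℝ (ℕ.pred m)

infix 4 _≡_[mod_]

_≡_[mod_] : ℕ → ℕ → ℕ → Set
a ≡ b [mod m ] = m ℕ.∣ ℕ.∣ a - b ∣

-- i + j = k in ℤ/m.  As k is a nonzero residue, this entails i + j ≠ 0.
Adds : ∀ m → Index m → Index m → Index m → Set
Adds m i j k = (residue i ℕ.+ residue j) ≡ residue k [mod m ]

GroupCone : ∀ m → Pred (Point m) 0ℓ
GroupCone m x = ∀ i j k → Adds m i j k → x k ≤ x i + x j

-- A face is cut out of the cone by turning some collection E of its defining
-- inequalities into equalities; (i , j) stands for xᵢ + xⱼ ≥ xᵢ₊ⱼ.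
IsFace : ∀ m → Pred (Point m) 0ℓ → Set₁
IsFace m F =
  Σ[ E ∈ Rel (Index m) 0ℓ ] ∀ (x : Point m) →
    x ∈ F ⇔
    (x ∈ GroupCone m × (∀ i j k → E i j → Adds m i j k → x i + x j ≈ x k))

record IsNumericalSemigroup (S : Pred ℕ 0ℓ) : Set where
  field
    0∈                : 0 ∈ S
    +-closed          : ∀ {a b} → a ∈ S → b ∈ S → (a ℕ.+ b) ∈ S
    finite-complement : ∃[ N ] (∀ n → N ℕ.≤ n → n ∈ S)

⟨_⟩ : ∀ {k} → Vector ℕ k → Pred ℕ 0ℓ
⟨_⟩ {k} g n =
  Σ[ c ∈ Vector ℕ k ] n ≡ Sum.sum ℕ.+-0-rawMonoid (λ i → c i ℕ.* g i)

-- { n ∈ S : n - m ∉ S }; a negative n - m is not in S.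
Ap : Pred ℕ 0ℓ → ℕ → Pred ℕ 0ℓ
Ap S m n = n ∈ S × ¬ (m ℕ.≤ n × (n ℕ.∸ m) ∈ S)

IsAperyTuple : Pred ℕ 0ℓ → (m : ℕ) → Vector ℕ (ℕ.pred m) → Set
IsAperyTuple S m a =
  ∀ i → a i ∈ Ap S m × a i ≡ residue i [mod m ]

Contains : ∀ m → Pred (Point m) 0ℓ → Pred ℕ 0ℓ → Set
Contains m F S =
  Σ[ a ∈ Vector ℕ (ℕ.pred m) ]
    (IsAperyTuple S m a × (λ i → fromℕ (a i)) ∈ RelativeInterior F)

gluing : ℕ → ℕ → Pred ℕ 0ℓ → Pred ℕ 0ℓ
gluing α β S n = ∃[ c ] ∃[ s ] (s ∈ S × n ≡ c ℕ.* α ℕ.+ β ℕ.* s)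

{-# OPTIONS --safe #-}

-- Let a be the Apéry tuple of S, lying in the relative interior of F.  The
-- affine span of F is the linear space V(a) of all x which satisfy
-- xᵢ + xⱼ = xᵢ₊ⱼ whenever aᵢ + aⱼ = aᵢ₊ⱼ.  The element of Ap(T; βm) congruent
-- to βi + αj, where j < β, is βaᵢ + αj.  Its relations either come from those of
-- S, or they carry j past β, and the latter happens only if α = a_α.  Hence
-- y ↦ (y_α , (y_{βi})ᵢ) maps V(b), for b the Apéry tuple of T, isomorphically
-- onto ℝ × V(a) if α ∉ Ap(S; m), and onto the pairs (z , x) with βz = x_α
-- if α ∈ Ap(S; m).  As V(a) is cut out by rational equations, its dimension can
-- be found by Gaussian elimination although equality on ℝ is undecidable.
module Submission where

open import Defs
open import Algebra.Bundles using (CommutativeRing)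
import Algebra.Definitions.RawMonoid as RawMonoid
import Algebra.Solver.Ring
open import Algebra.Solver.Ring.AlmostCommutativeRing using (fromCommutativeRing; _-Raw-AlmostCommutative⟶_)
open import Data.Fin using (Fin; zero; suc; toℕ)
import Data.Fin.Properties as Fin
open import Data.Integer using (+_)
import Data.Integer as ℤ
import Data.Integer.Properties as ℤ
open import Data.List using (List)
import Data.List as List
open import Data.List.Membership.Propositional using (find)
import Data.List.Membership.Propositional as List
import Data.List.Membership.Propositional.Properties as List
open import Data.List.Relation.Unary.All as All using (All)
import Data.List.Relation.Unary.All.Properties as All
import Data.Maybe as Maybe
open import Data.Nat using (ℕ; zero; suc; _*_; _<_; _≤_)
import Data.Nat as ℕ
import Data.Nat.Coprimality as Coprimality
import Data.Nat.Divisibility as ℕ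
import Data.Nat.DivMod as ℕ
open import Data.Nat.GCD using (gcd; module Bézout)
import Data.Nat.Properties as ℕ
open import Data.Nat.Solver using (module +-*-Solver)
open import Data.Product using (∃-syntax; _×_; _,_; proj₁; proj₂)
open import Data.Rational as ℚ using (ℚ; 0ℚ; 1ℚ)
import Data.Rational.Properties as ℚ
import Data.Rational.Solver as ℚ
import Data.Rational.Unnormalised as ℚᵘ
import Data.Rational.Unnormalised.Properties as ℚᵘ
open import Data.Sum using (_⊎_; inj₁; inj₂; [_,_]′)
open import Data.Unit using (⊤; tt)
open import Data.Vec.Functional using (Vector; _∷_; []; head; tail)
open import Function using (_∘_; id)
open import Function.Bundles using (Equivalence)
open import Level using (0ℓ)
open import Relation.Binary.Definitions using (tri<; tri≈; tri>)
open import Relation.Binary.PropositionalEquality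
  using (_≡_; _≢_; refl; sym; trans; cong; cong₂; subst; subst₂; module ≡-Reasoning)
import Relation.Binary.Reasoning.Setoid as SetoidReasoning
open import Relation.Nullary using (Dec; yes; no; contradiction)
open import Relation.Nullary.Decidable using (dec⇒maybe; _×-dec_)
open import Relation.Unary using (Pred; _∈_; _∉_)

-- `HasDim` asks for an explicit affine basis, so spaces are compared throughout by pairs of linear
-- maps inverse to each other, along which the standard basis of some `ℝᵈ` is pulled back. A single
-- `d`, found by eliminating for `V(a)`, thereby settles the dimensions of both faces. The set `E`
-- that defines a face may be chosen in several ways, but an interior point with integer coordinates
-- removes the ambiguity: a defining inequality is either an equality at that point, and then on the
-- whole face, or it has slack at least 1 there, and then it does not restrict small movements. The
-- relation `βz = x_α` has the following origin. Adding `α` to itself `β` times reaches the residue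
-- `βα`, whose Apéry element in `T` is `βa_α`. The last of these additions is tight precisely if
-- `βα = βa_α`.

module R = Real
open Real using (ℝ; _≈_; 0#; 1#; fromℚ; fromℕ; seq; ∑)

-- Real numbers

Eventually : (ℕ → Set) → Set
Eventually P = ∃[ N ] (∀ i → N ≤ i → P i)

both : ∀ {P Q R : ℕ → Set} → (∀ i → P i → Q i → R i) →
       Eventually P → Eventually Q → Eventually R
both f (M , p) (N , q) = M ℕ.⊔ N , λ i h →
  f i (p i (ℕ.m⊔n≤o⇒m≤o M N h)) (q i (ℕ.m⊔n≤o⇒n≤o M N h))

eventually-map : ∀ {P Q : ℕ → Set} → (∀ i → P i → Q i) → Eventually P → Eventually Q
eventually-map f (N , p) = N , λ i h → f i (p i h)

½*-pos : ∀ {ε} → 0ℚ ℚ.< ε → 0ℚ ℚ.< ℚ.½ ℚ.* ε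
½*-pos = ℚ.*-monoʳ-<-pos ℚ.½

½*+½* : ∀ ε → ℚ.½ ℚ.* ε ℚ.+ ℚ.½ ℚ.* ε ≡ ε
½*+½* ε = trans (sym (ℚ.*-distribʳ-+ ε ℚ.½ ℚ.½)) (ℚ.*-identityˡ ε)

*-pos : ∀ {p q} → 0ℚ ℚ.< p → 0ℚ ℚ.< q → 0ℚ ℚ.< p ℚ.* q
*-pos {p} {q} 0<p 0<q =
  subst (ℚ._< p ℚ.* q) (ℚ.*-zeroʳ p) (ℚ.*-monoʳ-<-pos p {{ℚ.positive 0<p}} 0<q)

positive-inverse : ∀ {p} → 0ℚ ℚ.< p → ∃[ q ] (0ℚ ℚ.< q × p ℚ.* q ≡ 1ℚ)
positive-inverse {p} 0<p = r , ℚ.positive⁻¹ r {{ℚ.1/pos⇒pos p {{p>0}}}} ,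
    ℚ.*-inverseʳ p {{ℚ.pos⇒nonZero p {{p>0}}}}
  where
  p>0 = ℚ.positive 0<p
  r = (ℚ.1/ p) {{ℚ.pos⇒nonZero p {{p>0}}}}

p≤∣p∣ : ∀ p → p ℚ.≤ ℚ.∣ p ∣
p≤∣p∣ p with ℚ.≤-total 0ℚ p
... | inj₁ 0≤p = ℚ.≤-reflexive (sym (ℚ.0≤p⇒∣p∣≡p 0≤p))
... | inj₂ p≤0 = ℚ.≤-trans p≤0 (ℚ.0≤∣p∣ p)

triangle : ∀ {ε δ} p q r → ℚ.∣ p ℚ.- q ∣ ℚ.< ε → ℚ.∣ q ℚ.- r ∣ ℚ.< δ →
           ℚ.∣ p ℚ.- r ∣ ℚ.< ε ℚ.+ δ
triangle {ε} {δ} p q r h k = begin-strict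
  ℚ.∣ p ℚ.- r ∣                       ≡⟨ cong ℚ.∣_∣ (split p q r) ⟩
  ℚ.∣ (p ℚ.- q) ℚ.+ (q ℚ.- r) ∣       ≤⟨ ℚ.∣p+q∣≤∣p∣+∣q∣ (p ℚ.- q) (q ℚ.- r) ⟩
  ℚ.∣ p ℚ.- q ∣ ℚ.+ ℚ.∣ q ℚ.- r ∣     <⟨ ℚ.+-mono-< h k ⟩
  ε ℚ.+ δ                             ∎
  where
  open ℚ.≤-Reasoning
  open ℚ.+-*-Solver
  split : ∀ p q r → p ℚ.- r ≡ (p ℚ.- q) ℚ.+ (q ℚ.- r)
  split = solve 3 (λ p q r → p :- r := (p :- q) :+ (q :- r)) refl

∣p-q∣≡∣q-p∣ : ∀ p q → ℚ.∣ p ℚ.- q ∣ ≡ ℚ.∣ q ℚ.- p ∣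
∣p-q∣≡∣q-p∣ p q = trans (sym (ℚ.∣-p∣≡∣p∣ (p ℚ.- q))) (cong ℚ.∣_∣ (flip p q))
  where
  open ℚ.+-*-Solver
  flip : ∀ p q → ℚ.- (p ℚ.- q) ≡ q ℚ.- p
  flip = solve 2 (λ p q → :- (p :- q) := q :- p) refl

eventually-bounded : ∀ x → ∃[ B ] (0ℚ ℚ.< B × Eventually (λ i → ℚ.∣ seq x i ∣ ℚ.≤ B))
eventually-bounded x =
  let N , p = R.cauchy x 1ℚ (ℚ.positive⁻¹ 1ℚ)
      c = seq x N
  in 1ℚ ℚ.+ ℚ.∣ c ∣
   , ℚ.<-≤-trans (ℚ.positive⁻¹ 1ℚ)
       (ℚ.≤-trans (ℚ.≤-reflexive (sym (ℚ.+-identityʳ 1ℚ))) (ℚ.+-monoʳ-≤ 1ℚ (ℚ.0≤∣p∣ c)))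
   , N , λ i h → ℚ.<⇒≤ (widen (seq x i) c (p i N h ℕ.≤-refl))
  where
  open ℚ.≤-Reasoning
  widen : ∀ p q → ℚ.∣ p ℚ.- q ∣ ℚ.< 1ℚ → ℚ.∣ p ∣ ℚ.< 1ℚ ℚ.+ ℚ.∣ q ∣
  widen p q h = begin-strict
    ℚ.∣ p ∣                      ≡⟨ cong ℚ.∣_∣ (split p q) ⟩
    ℚ.∣ (p ℚ.- q) ℚ.+ q ∣        ≤⟨ ℚ.∣p+q∣≤∣p∣+∣q∣ (p ℚ.- q) q ⟩
    ℚ.∣ p ℚ.- q ∣ ℚ.+ ℚ.∣ q ∣    <⟨ ℚ.+-monoˡ-< ℚ.∣ q ∣ h ⟩
    1ℚ ℚ.+ ℚ.∣ q ∣               ∎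
    where
    open ℚ.+-*-Solver
    split : ∀ p q → p ≡ (p ℚ.- q) ℚ.+ q
    split = solve 2 (λ p q → p := (p :- q) :+ q) refl

opaque
  unfolding Real._≈_ Real._+_

  -- The operations act termwise, so through this lemma each ring law of the reals follows from the
  -- same law of the rationals.
  seq-≡⇒≈ : ∀ x y → (∀ i → seq x i ≡ seq y i) → x ≈ y
  seq-≡⇒≈ x y eq ε 0<ε = 0 , λ i _ → subst (ℚ._< ε)
    (sym (trans (cong (λ z → ℚ.∣ z ℚ.- seq y i ∣) (eq i)) (cong ℚ.∣_∣ (ℚ.+-inverseʳ (seq y i))))) 0<ε

  ≈-sym : ∀ {x y} → x ≈ y → y ≈ x
  ≈-sym {x} {y} h ε 0<ε =
    eventually-map (λ i → subst (ℚ._< ε) (∣p-q∣≡∣q-p∣ (seq x i) (seq y i))) (h ε 0<ε)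

  ≈-trans : ∀ {x y z} → x ≈ y → y ≈ z → x ≈ z
  ≈-trans {x} {y} {z} h k ε 0<ε =
    both (λ i p q → subst (ℚ.∣ seq x i ℚ.- seq z i ∣ ℚ.<_) (½*+½* ε)
                          (triangle (seq x i) (seq y i) (seq z i) p q))
         (h _ (½*-pos 0<ε)) (k _ (½*-pos 0<ε))

  +-congʳ : ∀ {x y} z → x ≈ y → x R.+ z ≈ y R.+ z
  +-congʳ {x} {y} z h ε 0<ε =
    eventually-map (λ i → subst (ℚ._< ε) (cong ℚ.∣_∣ (cancel (seq x i) (seq y i) (seq z i)))) (h ε 0<ε)
    where
    open ℚ.+-*-Solver
    cancel : ∀ p q r → p ℚ.- q ≡ (p ℚ.+ r) ℚ.- (q ℚ.+ r)
    cancel = solve 3 (λ p q r → p :- q := (p :+ r) :- (q :+ r)) refl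

  neg-cong : ∀ {x y} → x ≈ y → R.- x ≈ R.- y
  neg-cong {x} {y} h ε 0<ε =
    eventually-map (λ i → subst (ℚ._< ε) (trans (∣p-q∣≡∣q-p∣ (seq x i) (seq y i))
      (cong ℚ.∣_∣ (flip (seq x i) (seq y i))))) (h ε 0<ε)
    where
    open ℚ.+-*-Solver
    flip : ∀ p q → q ℚ.- p ≡ ℚ.- p ℚ.- ℚ.- q
    flip = solve 2 (λ p q → q :- p := :- p :- :- q) refl

  *-congʳ : ∀ {x y} z → x ≈ y → x R.* z ≈ y R.* z
  *-congʳ {x} {y} z h ε 0<ε =
    -- Eventually `|z| ≤ B`, so a difference below `ε / B` between `x` and `y` suffices.
    let B , 0<B , z≤B = eventually-bounded z
        r , 0<r , Br = positive-inverse 0<B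
    in both (λ i p q → scaled (seq x i) (seq y i) (seq z i) B r 0<B Br p q) (h (r ℚ.* ε) (*-pos 0<r 0<ε)) z≤B
    where
    open ℚ.≤-Reasoning
    open ℚ.+-*-Solver
    factor : ∀ p q r → p ℚ.* r ℚ.- q ℚ.* r ≡ (p ℚ.- q) ℚ.* r
    factor = solve 3 (λ p q r → p :* r :- q :* r := (p :- q) :* r) refl
    scaled : ∀ p q c B r → 0ℚ ℚ.< B → B ℚ.* r ≡ 1ℚ → ℚ.∣ p ℚ.- q ∣ ℚ.< r ℚ.* ε → ℚ.∣ c ∣ ℚ.≤ B →
             ℚ.∣ p ℚ.* c ℚ.- q ℚ.* c ∣ ℚ.< ε
    scaled p q c B r 0<B Br d c≤B = begin-strict
      ℚ.∣ p ℚ.* c ℚ.- q ℚ.* c ∣      ≡⟨ cong ℚ.∣_∣ (factor p q c) ⟩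
      ℚ.∣ (p ℚ.- q) ℚ.* c ∣          ≡⟨ ℚ.∣p*q∣≡∣p∣*∣q∣ (p ℚ.- q) c ⟩
      ℚ.∣ p ℚ.- q ∣ ℚ.* ℚ.∣ c ∣      ≤⟨ ℚ.*-monoˡ-≤-nonNeg ℚ.∣ p ℚ.- q ∣ {{ℚ.∣-∣-nonNeg (p ℚ.- q)}} c≤B ⟩
      ℚ.∣ p ℚ.- q ∣ ℚ.* B            <⟨ ℚ.*-monoˡ-<-pos B {{ℚ.positive 0<B}} d ⟩
      r ℚ.* ε ℚ.* B                  ≡⟨ solve 3 (λ r ε B → r :* ε :* B := B :* r :* ε) refl r ε B ⟩
      B ℚ.* r ℚ.* ε                  ≡⟨ cong (ℚ._* ε) Br ⟩
      1ℚ ℚ.* ε                       ≡⟨ ℚ.*-identityˡ ε ⟩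
      ε                              ∎

  +-comm : ∀ x y → x R.+ y ≈ y R.+ x
  +-comm x y = seq-≡⇒≈ (x R.+ y) (y R.+ x) λ i → ℚ.+-comm (seq x i) (seq y i)

  +-assoc : ∀ x y z → (x R.+ y) R.+ z ≈ x R.+ (y R.+ z)
  +-assoc x y z = seq-≡⇒≈ ((x R.+ y) R.+ z) (x R.+ (y R.+ z)) λ i → ℚ.+-assoc (seq x i) (seq y i) (seq z i)

  +-identityˡ : ∀ x → 0# R.+ x ≈ x
  +-identityˡ x = seq-≡⇒≈ (0# R.+ x) (x) λ i → ℚ.+-identityˡ (seq x i)

  +-inverseˡ : ∀ x → R.- x R.+ x ≈ 0#
  +-inverseˡ x = seq-≡⇒≈ (R.- x R.+ x) (0#) λ i → ℚ.+-inverseˡ (seq x i)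

  *-comm : ∀ x y → x R.* y ≈ y R.* x
  *-comm x y = seq-≡⇒≈ (x R.* y) (y R.* x) λ i → ℚ.*-comm (seq x i) (seq y i)

  *-assoc : ∀ x y z → (x R.* y) R.* z ≈ x R.* (y R.* z)
  *-assoc x y z = seq-≡⇒≈ ((x R.* y) R.* z) (x R.* (y R.* z)) λ i → ℚ.*-assoc (seq x i) (seq y i) (seq z i)

  *-identityˡ : ∀ x → 1# R.* x ≈ x
  *-identityˡ x = seq-≡⇒≈ (1# R.* x) (x) λ i → ℚ.*-identityˡ (seq x i)

  *-distribˡ-+ : ∀ x y z → x R.* (y R.+ z) ≈ x R.* y R.+ x R.* z
  *-distribˡ-+ x y z = seq-≡⇒≈ (x R.* (y R.+ z)) (x R.* y R.+ x R.* z) λ i → ℚ.*-distribˡ-+ (seq x i) (seq y i) (seq z i)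

  fromℚ-+ : ∀ p q → fromℚ (p ℚ.+ q) ≈ fromℚ p R.+ fromℚ q
  fromℚ-+ p q = seq-≡⇒≈ (fromℚ (p ℚ.+ q)) (fromℚ p R.+ fromℚ q) λ i → refl

  fromℚ-* : ∀ p q → fromℚ (p ℚ.* q) ≈ fromℚ p R.* fromℚ q
  fromℚ-* p q = seq-≡⇒≈ (fromℚ (p ℚ.* q)) (fromℚ p R.* fromℚ q) λ i → refl

  fromℚ-neg : ∀ p → fromℚ (ℚ.- p) ≈ R.- fromℚ p
  fromℚ-neg p = seq-≡⇒≈ (fromℚ (ℚ.- p)) (R.- fromℚ p) λ i → refl

≈-refl : ∀ {x} → x ≈ x
≈-refl {x} = seq-≡⇒≈ x x λ _ → refl

ℝ-commutativeRing : CommutativeRing 0ℓ 0ℓ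
ℝ-commutativeRing = record
  { Carrier = ℝ ; _≈_ = _≈_ ; _+_ = R._+_ ; _*_ = R._*_ ; -_ = R.-_ ; 0# = 0# ; 1# = 1#
  ; isCommutativeRing = record
    { isRing = record
      { +-isAbelianGroup = record
        { isGroup = record
          { isMonoid = record
            { isSemigroup = record
              { isMagma = record
                { isEquivalence = record { refl = ≈-refl ; sym = ≈-sym ; trans = ≈-trans }
                ; ∙-cong = λ {x} {y} {u} {v} p q → ≈-trans (+-congʳ u p)
                    (≈-trans (+-comm y u) (≈-trans (+-congʳ y q) (+-comm v y))) }
              ; assoc = +-assoc }
            ; identity = +-identityˡ , λ x → ≈-trans (+-comm x 0#) (+-identityˡ x) }
          ; inverse = +-inverseˡ , λ x → ≈-trans (+-comm x (R.- x)) (+-inverseˡ x)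
          ; ⁻¹-cong = neg-cong }
        ; comm = +-comm }
      ; *-cong = λ {x} {y} {u} {v} p q → ≈-trans (*-congʳ u p)
          (≈-trans (*-comm y u) (≈-trans (*-congʳ y q) (*-comm v y)))
      ; *-assoc = *-assoc
      ; *-identity = *-identityˡ , λ x → ≈-trans (*-comm x 1#) (*-identityˡ x)
      ; distrib = *-distribˡ-+ , λ x y z → ≈-trans (*-comm (y R.+ z) x) (≈-trans (*-distribˡ-+ x y z)
          (≈-trans (+-congʳ _ (*-comm x y)) (≈-trans (+-comm _ _) (≈-trans (+-congʳ _ (*-comm x z)) (+-comm _ _))))) }
    ; *-comm = *-comm } }

open CommutativeRing ℝ-commutativeRing
  using ( semiring; setoid; +-monoid; +-rawMonoid; +-commutativeSemigroup
        ; +-cong; +-congˡ; *-congˡ; +-identityʳ; zeroˡ; zeroʳ; -‿inverseʳ)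
open import Algebra.Definitions.RawMonoid +-rawMonoid using () renaming (_×_ to _·_)
open import Algebra.Properties.CommutativeSemigroup +-commutativeSemigroup using (interchange; x∙yz≈y∙xz)
open import Algebra.Properties.Monoid.Mult +-monoid using () renaming (×-homo-+ to ·-homo-+)
open import Algebra.Properties.Ring (CommutativeRing.ring ℝ-commutativeRing) using (-‿distribʳ-*)
open import Algebra.Properties.Semiring.Sum semiring
  using (sum-cong-≋; ∑-distrib-+; *-distribˡ-sum; sum-replicate-zero)

fromℚ-morphism : CommutativeRing.rawRing ℚ.+-*-commutativeRing
                   -Raw-AlmostCommutative⟶ fromCommutativeRing ℝ-commutativeRing
fromℚ-morphism = record
  { ⟦_⟧ = fromℚ ; +-homo = fromℚ-+ ; *-homo = fromℚ-* ; -‿homo = fromℚ-neg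
  ; 0-homo = ≈-refl ; 1-homo = ≈-refl }

fromℚ-cong : ∀ {p q} → p ≡ q → fromℚ p ≈ fromℚ q
fromℚ-cong refl = ≈-refl

-- The coefficients are rationals: their equality is decidable, as the solver requires, while that
-- of the reals is not.
module ℝ-Solver = Algebra.Solver.Ring _ (fromCommutativeRing ℝ-commutativeRing) fromℚ-morphism
  (λ p q → Maybe.map fromℚ-cong (dec⇒maybe (p ℚ.≟ q)))

-- The order on the reals and rational bounds

opaque
  unfolding Real._≈_ Real._+_

  ≈⇒≤ : ∀ {x y} → x ≈ y → x R.≤ y
  ≈⇒≤ {x} {y} h ε 0<ε = eventually-map (λ i → bound (seq x i) (seq y i)) (h ε 0<ε)
    where
    open ℚ.≤-Reasoning
    open ℚ.+-*-Solver
    bound : ∀ p q → ℚ.∣ p ℚ.- q ∣ ℚ.< ε → p ℚ.< q ℚ.+ ε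
    bound p q h = begin-strict
      p                        ≡⟨ solve 2 (λ p q → p := q :+ (p :- q)) refl p q ⟩
      q ℚ.+ (p ℚ.- q)          ≤⟨ ℚ.+-monoʳ-≤ q (p≤∣p∣ (p ℚ.- q)) ⟩
      q ℚ.+ ℚ.∣ p ℚ.- q ∣      <⟨ ℚ.+-monoʳ-< q h ⟩
      q ℚ.+ ε                  ∎

  ≤-trans : ∀ {x y z} → x R.≤ y → y R.≤ z → x R.≤ z
  ≤-trans {x} {y} {z} h k ε 0<ε =
    both (λ i p q → chain (seq x i) (seq y i) (seq z i) p q) (h _ (½*-pos 0<ε)) (k _ (½*-pos 0<ε))
    where
    open ℚ.≤-Reasoning
    δ : ℚ
    δ = ℚ.½ ℚ.* ε
    chain : ∀ p q r → p ℚ.< q ℚ.+ δ → q ℚ.< r ℚ.+ δ → p ℚ.< r ℚ.+ ε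
    chain p q r h k = begin-strict
      p                    <⟨ h ⟩
      q ℚ.+ δ              <⟨ ℚ.+-monoˡ-< δ k ⟩
      (r ℚ.+ δ) ℚ.+ δ      ≡⟨ ℚ.+-assoc r δ δ ⟩
      r ℚ.+ (δ ℚ.+ δ)      ≡⟨ cong (r ℚ.+_) (½*+½* ε) ⟩
      r ℚ.+ ε              ∎

  ≤-antisym : ∀ {x y} → x R.≤ y → y R.≤ x → x ≈ y
  ≤-antisym {x} {y} h k ε 0<ε =
    both (λ i p q → close (seq x i) (seq y i) p q) (h ε 0<ε) (k ε 0<ε)
    where
    open ℚ.≤-Reasoning
    open ℚ.+-*-Solver
    less : ∀ p q → p ℚ.< q ℚ.+ ε → p ℚ.- q ℚ.< ε
    less p q h = begin-strict
      p ℚ.- q             <⟨ ℚ.+-monoˡ-< (ℚ.- q) h ⟩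
      (q ℚ.+ ε) ℚ.- q     ≡⟨ solve 2 (λ q ε → (q :+ ε) :- q := ε) refl q ε ⟩
      ε                   ∎
    close : ∀ p q → p ℚ.< q ℚ.+ ε → q ℚ.< p ℚ.+ ε → ℚ.∣ p ℚ.- q ∣ ℚ.< ε
    close p q h k with ℚ.∣p∣≡p∨∣p∣≡-p (p ℚ.- q)
    ... | inj₁ eq = subst (ℚ._< ε) (sym eq) (less p q h)
    ... | inj₂ eq = subst (ℚ._< ε)
      (trans (solve 2 (λ p q → q :- p := :- (p :- q)) refl p q) (sym eq)) (less q p k)

  +-mono-≤ : ∀ {x y u v} → x R.≤ y → u R.≤ v → x R.+ u R.≤ y R.+ v
  +-mono-≤ {x} {y} {u} {v} h k ε 0<ε =
    both (λ i p q → subst (seq x i ℚ.+ seq u i ℚ.<_)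
           (trans (rearrange (seq y i) (seq v i) (ℚ.½ ℚ.* ε)) (cong (seq y i ℚ.+ seq v i ℚ.+_) (½*+½* ε)))
           (ℚ.+-mono-< p q))
      (h _ (½*-pos 0<ε)) (k _ (½*-pos 0<ε))
    where
    open ℚ.+-*-Solver
    rearrange : ∀ q r δ → (q ℚ.+ δ) ℚ.+ (r ℚ.+ δ) ≡ (q ℚ.+ r) ℚ.+ (δ ℚ.+ δ)
    rearrange = solve 3 (λ q r δ → (q :+ δ) :+ (r :+ δ) := (q :+ r) :+ (δ :+ δ)) refl

  fromℚ-*-mono-≤ : ∀ {p x y} → 0ℚ ℚ.< p → x R.≤ y → fromℚ p R.* x R.≤ fromℚ p R.* y
  fromℚ-*-mono-≤ {p} {x} {y} 0<p h ε 0<ε =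
    let q , 0<q , pq = positive-inverse 0<p
    in eventually-map (λ i → scaled (seq x i) (seq y i) q pq) (h (q ℚ.* ε) (*-pos 0<q 0<ε))
    where
    open ℚ.≤-Reasoning
    open ℚ.+-*-Solver
    scaled : ∀ a b q → p ℚ.* q ≡ 1ℚ → a ℚ.< b ℚ.+ q ℚ.* ε → p ℚ.* a ℚ.< p ℚ.* b ℚ.+ ε
    scaled a b q pq h = begin-strict
      p ℚ.* a                          <⟨ ℚ.*-monoʳ-<-pos p {{ℚ.positive 0<p}} h ⟩
      p ℚ.* (b ℚ.+ q ℚ.* ε)            ≡⟨ solve 4 (λ p q b ε → p :* (b :+ q :* ε) := p :* b :+ p :* q :* ε) refl p q b ε ⟩
      p ℚ.* b ℚ.+ p ℚ.* q ℚ.* ε        ≡⟨ cong (λ c → p ℚ.* b ℚ.+ c ℚ.* ε) pq ⟩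
      p ℚ.* b ℚ.+ 1ℚ ℚ.* ε             ≡⟨ cong (p ℚ.* b ℚ.+_) (ℚ.*-identityˡ ε) ⟩
      p ℚ.* b ℚ.+ ε                    ∎

  fromℚ-mono-≤ : ∀ {p q} → p ℚ.≤ q → fromℚ p R.≤ fromℚ q
  fromℚ-mono-≤ {p} {q} h ε 0<ε = 0 , λ _ _ → subst (ℚ._< q ℚ.+ ε) (ℚ.+-identityʳ p) (ℚ.+-mono-≤-< h 0<ε)

  fromℚ-injective : ∀ {p q} → fromℚ p ≈ fromℚ q → p ≡ q
  fromℚ-injective {p} {q} h with ℚ.∣ p ℚ.- q ∣ ℚ.≟ 0ℚ
  ... | yes eq = trans (solve 2 (λ p q → p := (p :- q) :+ q) refl p q)
                   (trans (cong (ℚ._+ q) (ℚ.∣p∣≡0⇒p≡0 (p ℚ.- q) eq)) (ℚ.+-identityˡ q))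
    where open ℚ.+-*-Solver
  ... | no ≢0 =
    let ∣p-q∣>0 = ℚ.positive⁻¹ _ {{ℚ.nonNeg∧nonZero⇒pos ℚ.∣ p ℚ.- q ∣ {{ℚ.∣-∣-nonNeg (p ℚ.- q)}} {{ℚ.≢-nonZero ≢0}}}}
        N , close = h ℚ.∣ p ℚ.- q ∣ ∣p-q∣>0
    in contradiction (close N ℕ.≤-refl) (ℚ.<-irrefl refl)

  -- The definition of `<` already carries a rational gap. Replacing the radius of a ball by it
  -- leaves only rational scalars to be inverted.
  0<⇒fromℚ≤ : ∀ {x} → 0# R.< x → ∃[ p ] (0ℚ ℚ.< p × fromℚ p R.≤ x)
  0<⇒fromℚ≤ {x} (p , 0<p , N , h) = p , 0<p , λ ε 0<ε → N , λ i N≤i →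
    subst₂ ℚ._<_ (trans (ℚ.+-identityʳ _) (ℚ.+-identityˡ p)) refl (ℚ.+-mono-< (h i N≤i) 0<ε)

  fromℚ-bounds : ∀ x → ∃[ B ] (0ℚ ℚ.< B × (R.- fromℚ B R.≤ x × x R.≤ fromℚ B))
  fromℚ-bounds x =
    let B , 0<B , h = eventually-bounded x
        upper : ∀ (p : ℚ) {ε} → ℚ.∣ p ∣ ℚ.≤ B → 0ℚ ℚ.< ε → p ℚ.< B ℚ.+ ε
        upper p ≤B 0<ε = subst (ℚ._< _) (ℚ.+-identityʳ p) (ℚ.+-mono-≤-< (ℚ.≤-trans (p≤∣p∣ p) ≤B) 0<ε)
        neg-neg : ∀ p → ℚ.- (ℚ.- p) ≡ p
        neg-neg = solve 1 (λ p → :- (:- p) := p) refl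
        lower : ∀ (p : ℚ) {ε} → ℚ.∣ p ∣ ℚ.≤ B → 0ℚ ℚ.< ε → ℚ.- B ℚ.< p ℚ.+ ε
        lower p {ε} ≤B 0<ε = subst₂ ℚ._<_ (ℚ.+-identityʳ (ℚ.- B)) refl
          (ℚ.+-mono-≤-< (subst (ℚ.- B ℚ.≤_) (neg-neg p)
             (ℚ.neg-antimono-≤ (ℚ.≤-trans (p≤∣p∣ (ℚ.- p)) (ℚ.≤-trans (ℚ.≤-reflexive (ℚ.∣-p∣≡∣p∣ p)) ≤B)))) 0<ε)
    in B , 0<B
     , (λ ε 0<ε → eventually-map (λ i b → lower (seq x i) b 0<ε) h)
     , (λ ε 0<ε → eventually-map (λ i b → upper (seq x i) b 0<ε) h)
    where open ℚ.+-*-Solver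

  ≤∧0<⇒< : ∀ {p x y} → 0ℚ ℚ.< p → x R.+ fromℚ p R.≤ y → x R.< y
  ≤∧0<⇒< {p} {x} {y} 0<p h =
    -- One half of the gap `p` absorbs the tolerance in `≤`; the other half remains as the witness
    -- of `<`.
    let N , k = h (ℚ.½ ℚ.* p) (½*-pos 0<p)
    in ℚ.½ ℚ.* p , ½*-pos 0<p , N , λ i N≤i → cancel (seq x i) (seq y i) (k i N≤i)
    where
    open ℚ.≤-Reasoning
    open ℚ.+-*-Solver
    cancel : ∀ a b → a ℚ.+ p ℚ.< b ℚ.+ ℚ.½ ℚ.* p → a ℚ.+ ℚ.½ ℚ.* p ℚ.< b
    cancel a b h = begin-strict
      a ℚ.+ ℚ.½ ℚ.* p                      ≡⟨ solve 2 (λ a p → a :+ con ℚ.½ :* p := (a :+ p) :- con ℚ.½ :* p) refl a p ⟩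
      (a ℚ.+ p) ℚ.- ℚ.½ ℚ.* p              <⟨ ℚ.+-monoˡ-< (ℚ.- (ℚ.½ ℚ.* p)) h ⟩
      (b ℚ.+ ℚ.½ ℚ.* p) ℚ.- ℚ.½ ℚ.* p      ≡⟨ solve 2 (λ b p → (b :+ con ℚ.½ :* p) :- con ℚ.½ :* p := b) refl b p ⟩
      b                                    ∎

fromℕ-+ : ∀ a b → fromℕ (a ℕ.+ b) ≈ fromℕ a R.+ fromℕ b
fromℕ-+ a b = ≈-trans (fromℚ-cong eq) (fromℚ-+ (+ a ℚ./ 1) (+ b ℚ./ 1))
  where
  open ℚᵘ.≃-Reasoning
  fraction : ℕ → ℚᵘ.ℚᵘ
  fraction n = ℚᵘ.mkℚᵘ (+ n) 0
  eq : + (a ℕ.+ b) ℚ./ 1 ≡ + a ℚ./ 1 ℚ.+ + b ℚ./ 1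
  eq = ℚ.toℚᵘ-injective (begin
    ℚ.toℚᵘ (ℚ.fromℚᵘ (fraction (a ℕ.+ b)))                ≈⟨ ℚ.toℚᵘ-fromℚᵘ (fraction (a ℕ.+ b)) ⟩
    fraction (a ℕ.+ b)
      ≈⟨ ℚᵘ.*≡* (cong (ℤ._* (+ 1)) (cong₂ ℤ._+_ (sym (ℤ.*-identityʳ (+ a))) (sym (ℤ.*-identityʳ (+ b))))) ⟩
    fraction a ℚᵘ.+ fraction b
      ≈⟨ ℚᵘ.+-cong (ℚ.toℚᵘ-fromℚᵘ (fraction a)) (ℚ.toℚᵘ-fromℚᵘ (fraction b)) ⟨
    ℚ.toℚᵘ (+ a ℚ./ 1) ℚᵘ.+ ℚ.toℚᵘ (+ b ℚ./ 1)            ≈⟨ ℚ.toℚᵘ-homo-+ (+ a ℚ./ 1) (+ b ℚ./ 1) ⟨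
    ℚ.toℚᵘ (+ a ℚ./ 1 ℚ.+ + b ℚ./ 1)                      ∎)

fromℕ-injective : ∀ {a b} → fromℕ a ≈ fromℕ b → a ≡ b
fromℕ-injective {a} {b} h =
  ℤ.+-injective (ℤ.*-cancelʳ-≡ (+ a) (+ b) (+ 1) (ℚᵘ.drop-*≡*
    (ℚ.fromℚᵘ-injective {ℚᵘ.mkℚᵘ (+ a) 0} {ℚᵘ.mkℚᵘ (+ b) 0} (fromℚ-injective h))))

≤-respʳ-≈ : ∀ {x y z} → x R.≤ y → y ≈ z → x R.≤ z
≤-respʳ-≈ h eq = ≤-trans h (≈⇒≤ eq)

≤-respˡ-≈ : ∀ {x y z} → x R.≤ y → x ≈ z → z R.≤ y
≤-respˡ-≈ h eq = ≤-trans (≈⇒≤ (≈-sym eq)) h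

≤-refl : ∀ {x} → x R.≤ x
≤-refl = ≈⇒≤ ≈-refl

fromℕ-mono-≤ : ∀ {a b} → a ≤ b → fromℕ a R.≤ fromℕ b
fromℕ-mono-≤ {a} {b} a≤b = ≤-respʳ-≈
  (≤-respˡ-≈ (+-mono-≤ ≤-refl (fromℚ-mono-≤ (ℚ.nonNegative⁻¹ _ {{ℚ.normalize-nonNeg (b ℕ.∸ a) 1}})))
    (solve 1 (λ x → x :+ con 0ℚ := x) ≈-refl (fromℕ a)))
  (≈-trans (≈-sym (fromℕ-+ a (b ℕ.∸ a))) (fromℚ-cong (cong (λ n → + n ℚ./ 1) (ℕ.m+[n∸m]≡n a≤b))))
  where open ℝ-Solver

-- Two inequalities with the same difference of sides are equivalent, so rearranging one becomes an
-- identity for the ring solver.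
≤-shift : ∀ {x y u v} → x R.≤ y → y R.- x ≈ v R.- u → u R.≤ v
≤-shift {x} {y} {u} {v} h eq = ≤-respʳ-≈
  (≤-respˡ-≈ (+-mono-≤ h (≤-refl {u R.- x})) (solve 2 (λ x u → x :+ (u :- x) := u) ≈-refl x u))
  (≈-trans (solve 3 (λ x y u → y :+ (u :- x) := u :+ (y :- x)) ≈-refl x y u)
    (≈-trans (+-congˡ eq) (solve 2 (λ u v → u :+ (v :- u) := v) ≈-refl u v)))
  where
  open ℝ-Solver
≡⇒≈ : ∀ {x y} → x ≡ y → x ≈ y
≡⇒≈ refl = ≈-refl

·≈fromℕ* : ∀ n x → n · x ≈ fromℕ n R.* x
·≈fromℕ* zero    x = ≈-sym (zeroˡ x)
·≈fromℕ* (suc n) x = ≈-trans (+-congˡ (·≈fromℕ* n x)) (≈-trans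
  (solve 2 (λ x n → x :+ n :* x := (con 1ℚ :+ n) :* x) ≈-refl x (fromℕ n))
  (*-congʳ x (≈-sym (fromℕ-+ 1 n))))
  where open ℝ-Solver

-- This is the division by `β` that solves `βz = x_α` for `z`. The factor `c` does not depend on
-- `x`, so the solution is linear.
·-inverse : ∀ n → ∃[ c ] (∀ x → suc n · (c R.* x) ≈ x × c R.* (suc n · x) ≈ x)
·-inverse n =
  let q = + suc n ℚ./ 1
      r , _ , qr≡1 = positive-inverse (ℚ.positive⁻¹ q {{ℚ.normalize-pos (suc n) 1}})
      qr≈1 : fromℕ (suc n) R.* fromℚ r ≈ 1#
      qr≈1 = ≈-trans (≈-sym (fromℚ-* q r)) (fromℚ-cong qr≡1)
  in fromℚ r , λ x →
      ≈-trans (·≈fromℕ* (suc n) _) (cancel _ _ x (≈-trans (≈-sym (*-assoc _ _ x)) (*-congʳ x qr≈1)))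
    , ≈-trans (*-congˡ (·≈fromℕ* (suc n) x)) (cancel _ _ x (≈-trans (≈-sym (*-assoc _ _ x))
        (*-congʳ x (≈-trans (*-comm _ _) qr≈1))))
  where
  cancel : ∀ u v x → u R.* (v R.* x) ≈ 1# R.* x → u R.* (v R.* x) ≈ x
  cancel u v x h = ≈-trans h (*-identityˡ x)

bounds : ∀ {n} (z : Vector ℝ n) → ∃[ B ] (0ℚ ℚ.< B × ∀ i → R.- fromℚ B R.≤ z i × z i R.≤ fromℚ B)
bounds {zero}  z = 1ℚ , ℚ.positive⁻¹ 1ℚ , λ ()
bounds {suc n} z =
  let B , 0<B , -B≤z₀ , z₀≤B = fromℚ-bounds (head z)
      C , 0<C , bound        = bounds (tail z)
  in B ℚ.+ C , ℚ.+-mono-< 0<B 0<C , λ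
    { zero    → wider {B} (grow (ℚ.≤-reflexive refl) (ℚ.<⇒≤ 0<C)) -B≤z₀ z₀≤B
    ; (suc i) → wider {C} (subst (ℚ._≤ B ℚ.+ C) (ℚ.+-identityˡ C) (ℚ.+-monoˡ-≤ C (ℚ.<⇒≤ 0<B)))
                  (proj₁ (bound i)) (proj₂ (bound i)) }
  where
  grow : ∀ {p q r} → p ℚ.≤ q → 0ℚ ℚ.≤ r → p ℚ.≤ q ℚ.+ r
  grow {p} {q} {r} p≤q 0≤r = subst (ℚ._≤ q ℚ.+ r) (ℚ.+-identityʳ p) (ℚ.+-mono-≤ p≤q 0≤r)
  wider : ∀ {B B′ x} → B ℚ.≤ B′ → R.- fromℚ B R.≤ x → x R.≤ fromℚ B →
          R.- fromℚ B′ R.≤ x × x R.≤ fromℚ B′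
  wider {B} {B′} B≤B′ lower upper =
      ≤-trans (≤-shift (fromℚ-mono-≤ B≤B′)
        (solve 2 (λ B B′ → B′ :- B := (:- B) :- (:- B′)) ≈-refl (fromℚ B) (fromℚ B′))) lower
    , ≤-trans upper (fromℚ-mono-≤ B≤B′)
    where open ℝ-Solver

-- Shrinks a direction `z` into the box of radius `η`. The inverse `T` of the factor `t` is returned
-- as well, so that the shrinking can be undone afterwards.
scaled-bounds : ∀ {n} (z : Vector ℝ n) {η} → 0ℚ ℚ.< η →
  ∃[ t ] ∃[ T ] (0ℚ ℚ.< T × fromℚ T R.* fromℚ t ≈ 1# ×
    ∀ i → R.- fromℚ η R.≤ fromℚ t R.* z i × fromℚ t R.* z i R.≤ fromℚ η)
scaled-bounds z {η} 0<η =
  let B , 0<B , bound = bounds z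
      B⁻¹ , 0<B⁻¹ , BB⁻¹ = positive-inverse 0<B
      η⁻¹ , 0<η⁻¹ , ηη⁻¹ = positive-inverse 0<η
      t = η ℚ.* B⁻¹
      T = B ℚ.* η⁻¹
      0<t = *-pos 0<η 0<B⁻¹
      tB≈η : fromℚ t R.* fromℚ B ≈ fromℚ η
      tB≈η = ≈-trans (≈-sym (fromℚ-* t B)) (fromℚ-cong (trans
        (solve 3 (λ η r B → η :* r :* B := B :* r :* η) refl η B⁻¹ B)
        (trans (cong (ℚ._* η) BB⁻¹) (ℚ.*-identityˡ η))))
      Tt≈1 : fromℚ T R.* fromℚ t ≈ 1#
      Tt≈1 = ≈-trans (≈-sym (fromℚ-* T t)) (fromℚ-cong (trans
        (solve 4 (λ B r η s → B :* s :* (η :* r) := (B :* r) :* (η :* s)) refl B B⁻¹ η η⁻¹)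
        (trans (cong₂ ℚ._*_ BB⁻¹ ηη⁻¹) (ℚ.*-identityˡ 1ℚ))))
  in t , T , *-pos 0<B 0<η⁻¹ , Tt≈1 , λ i →
      ≤-respˡ-≈ (fromℚ-*-mono-≤ 0<t (proj₁ (bound i)))
        (≈-trans (≈-sym (-‿distribʳ-* (fromℚ t) (fromℚ B))) (neg-cong tB≈η))
    , ≤-respʳ-≈ (fromℚ-*-mono-≤ 0<t (proj₂ (bound i))) tB≈η
  where open ℚ.+-*-Solver

-- Turns a cone inequality at an Apéry tuple back into one between natural numbers, where tight and
-- slack can be told apart.
fromℕ-cancel-≤ : ∀ {a b} → fromℕ a R.≤ fromℕ b → a ≤ b
fromℕ-cancel-≤ h = ℕ.≮⇒≥ λ b<a →
  ℕ.<⇒≢ b<a (fromℕ-injective (≤-antisym (fromℕ-mono-≤ (ℕ.<⇒≤ b<a)) h))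

-- Linear maps on ℝⁿ

-- Linearity is stated for combinations of any length, the shape in which affine spans and bases use
-- it. The empty combination gives the value 0 at the zero vector.
record LinearForm {n} (g : Vector ℝ n → ℝ) : Set where
  field
    resp : ∀ {x y} → x ≋ y → g x ≈ g y
    homo : ∀ {k} (c : Vector ℝ k) v → g (combination c v) ≈ ∑ (λ j → c j R.* g (v j))

open LinearForm

Linear : ∀ {m n} → (Vector ℝ m → Vector ℝ n) → Set
Linear f = ∀ i → LinearForm (λ x → f x i)

coordinate-linear : ∀ {n} (i : Fin n) → LinearForm (λ x → x i)
coordinate-linear i = record { resp = λ h → h i ; homo = λ c v → ≈-refl }

∑-zero : ∀ {k} (f : Vector ℝ k) → (∀ j → f j ≈ 0#) → ∑ f ≈ 0#
∑-zero {k} f h = ≈-trans (sum-cong-≋ h) (sum-replicate-zero k)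

0-linear : ∀ {n} → LinearForm {n} (λ _ → 0#)
0-linear = record
  { resp = λ _ → ≈-refl ; homo = λ c v → ≈-sym (∑-zero _ (λ j → zeroʳ (c j))) }

+-linear : ∀ {n} {g h : Vector ℝ n → ℝ} → LinearForm g → LinearForm h → LinearForm (λ x → g x R.+ h x)
+-linear {g = g} {h} G H = record
  { resp = λ e → +-cong (resp G e) (resp H e)
  ; homo = λ c v → ≈-trans (+-cong (homo G c v) (homo H c v))
      (≈-trans (≈-sym (∑-distrib-+ (λ j → c j R.* g (v j)) (λ j → c j R.* h (v j))))
        (sum-cong-≋ (λ j → ≈-sym (*-distribˡ-+ (c j) (g (v j)) (h (v j)))))) }

*-linear : ∀ {n} {g : Vector ℝ n → ℝ} r → LinearForm g → LinearForm (λ x → r R.* g x)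
*-linear {g = g} r G = record
  { resp = λ e → *-congˡ (resp G e)
  ; homo = λ c v → ≈-trans (*-congˡ (homo G c v)) (≈-trans (*-distribˡ-sum r (λ j → c j R.* g (v j)))
      (sum-cong-≋ (λ j → solve 3 (λ r c g → r :* (c :* g) := c :* (r :* g)) ≈-refl r (c j) (g (v j))))) }
  where open ℝ-Solver

·-linear : ∀ {n} {g : Vector ℝ n → ℝ} m → LinearForm g → LinearForm (λ x → m · g x)
·-linear zero    G = 0-linear
·-linear (suc m) G = +-linear G (·-linear m G)

∑-linear : ∀ {n m} {g : Fin m → Vector ℝ n → ℝ} → (∀ i → LinearForm (g i)) → LinearForm (λ x → ∑ (λ i → g i x))
∑-linear {m = zero}  G = 0-linear
∑-linear {m = suc m} G = +-linear (G zero) (∑-linear (G ∘ suc))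

∘-linear : ∀ {m n} {f : Vector ℝ m → Vector ℝ n} {g} → LinearForm g → Linear f → LinearForm (g ∘ f)
∘-linear {f = f} {g} G F = record
  { resp = λ e → resp G (λ i → resp (F i) e)
  ; homo = λ c v → ≈-trans (resp G (λ i → homo (F i) c v)) (homo G c (f ∘ v)) }

forms-agree : ∀ {n k} {g h : Vector ℝ n → ℝ} → LinearForm g → LinearForm h →
  (c : Vector ℝ k) (v : Vector (Vector ℝ n) k) → (∀ j → g (v j) ≈ h (v j)) →
  g (combination c v) ≈ h (combination c v)
forms-agree G H c v e =
  ≈-trans (homo G c v) (≈-trans (sum-cong-≋ (λ j → *-congˡ (e j))) (≈-sym (homo H c v)))

combination-cong : ∀ {n k} (c : Vector ℝ k) {v w : Vector (Vector ℝ n) k} → (∀ j → v j ≋ w j) →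
                   combination c v ≋ combination c w
combination-cong c h i = sum-cong-≋ (λ j → *-congˡ (h j i))

infix 4 _≅_

-- The maps are linear on the whole ambient spaces but inverse to each other only between `P` and
-- `Q`. A coordinate that is determined by the others on `P` can thus simply be dropped.
record _≅_ {m n} (P : Pred (Vector ℝ m) 0ℓ) (Q : Pred (Vector ℝ n) 0ℓ) : Set where
  field
    to          : Vector ℝ m → Vector ℝ n
    from        : Vector ℝ n → Vector ℝ m
    to-linear   : Linear to
    from-linear : Linear from
    to-∈        : ∀ {x} → x ∈ P → to x ∈ Q
    from-∈      : ∀ {y} → y ∈ Q → from y ∈ P
    from-to     : ∀ {x} → x ∈ P → from (to x) ≋ x
    to-from     : ∀ {y} → y ∈ Q → to (from y) ≋ y

≅-trans : ∀ {l m n} {P : Pred (Vector ℝ l) 0ℓ} {Q : Pred (Vector ℝ m) 0ℓ} {S : Pred (Vector ℝ n) 0ℓ} →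
          P ≅ Q → Q ≅ S → P ≅ S
≅-trans I J = record
  { to = J.to ∘ I.to ; from = I.from ∘ J.from
  ; to-linear = λ i → ∘-linear (J.to-linear i) I.to-linear
  ; from-linear = λ i → ∘-linear (I.from-linear i) J.from-linear
  ; to-∈ = J.to-∈ ∘ I.to-∈ ; from-∈ = I.from-∈ ∘ J.from-∈
  ; from-to = λ x∈P i → ≈-trans (resp (I.from-linear i) (J.from-to (I.to-∈ x∈P))) (I.from-to x∈P i)
  ; to-from = λ y∈S i → ≈-trans (resp (J.to-linear i) (I.to-from (J.from-∈ y∈S))) (J.to-from y∈S i) }
  where
  module I = _≅_ I
  module J = _≅_ J

⇔⇒≅ : ∀ {n} {P Q : Pred (Vector ℝ n) 0ℓ} →
      (∀ {x} → x ∈ P → x ∈ Q) → (∀ {x} → x ∈ Q → x ∈ P) → P ≅ Q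
⇔⇒≅ P⊆Q Q⊆P = record
  { to = id ; from = id ; to-linear = coordinate-linear ; from-linear = coordinate-linear
  ; to-∈ = P⊆Q ; from-∈ = Q⊆P ; from-to = λ _ _ → ≈-refl ; to-from = λ _ _ → ≈-refl }

Everything : ∀ n → Pred (Vector ℝ n) 0ℓ
Everything n _ = ⊤

-- The product `ℝ × P`; its free first coordinate is where every additional dimension comes from.
Cylinder : ∀ {n} → Pred (Vector ℝ n) 0ℓ → Pred (Vector ℝ (suc n)) 0ℓ
Cylinder P x = tail x ∈ P

Cylinder-≅ : ∀ {m n} {P : Pred (Vector ℝ m) 0ℓ} {Q : Pred (Vector ℝ n) 0ℓ} →
             P ≅ Q → Cylinder P ≅ Cylinder Q
Cylinder-≅ {P = P} {Q} I = record
  { to = extend I.to ; from = extend I.from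
  ; to-linear = extend-linear I.to-linear ; from-linear = extend-linear I.from-linear
  ; to-∈ = I.to-∈ ; from-∈ = I.from-∈
  ; from-to = λ { x∈P zero → ≈-refl ; x∈P (suc i) → I.from-to x∈P i }
  ; to-from = λ { y∈Q zero → ≈-refl ; y∈Q (suc i) → I.to-from y∈Q i } }
  where
  module I = _≅_ I
  extend : ∀ {m n} → (Vector ℝ m → Vector ℝ n) → Vector ℝ (suc m) → Vector ℝ (suc n)
  extend f x = head x ∷ f (tail x)
  extend-linear : ∀ {m n} {f : Vector ℝ m → Vector ℝ n} → Linear f → Linear (extend f)
  extend-linear F zero    = coordinate-linear zero
  extend-linear F (suc i) = ∘-linear (F i) (coordinate-linear ∘ suc)

-- Systems of rational linear equations

⟪_⟫ : ∀ {n} → Vector ℚ n → Vector ℝ n → ℝ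
⟪ q ⟫ x = ∑ (λ j → fromℚ (q j) R.* x j)

⟪⟫-linear : ∀ {n} (q : Vector ℚ n) → LinearForm ⟪ q ⟫
⟪⟫-linear q = ∑-linear (λ j → *-linear (fromℚ (q j)) (coordinate-linear j))

⟪⟫-+* : ∀ {n} (p q : Vector ℚ n) r (x : Vector ℝ n) →
        ⟪ (λ i → p i ℚ.+ r ℚ.* q i) ⟫ x ≈ ⟪ p ⟫ x R.+ fromℚ r R.* ⟪ q ⟫ x
⟪⟫-+* p q r x = ≈-trans
  (sum-cong-≋ λ i → ≈-trans
    (*-congʳ (x i) (≈-trans (fromℚ-+ (p i) (r ℚ.* q i)) (+-congˡ (fromℚ-* r (q i)))))
    (solve 4 (λ p q r x → (p :+ r :* q) :* x := p :* x :+ r :* (q :* x)) ≈-refl (fromℚ (p i)) (fromℚ (q i)) (fromℚ r) (x i)))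
  (≈-trans (∑-distrib-+ (λ i → fromℚ (p i) R.* x i) (λ i → fromℚ r R.* (fromℚ (q i) R.* x i)))
    (+-congˡ (≈-sym (*-distribˡ-sum (fromℚ r) (λ i → fromℚ (q i) R.* x i)))))
  where open ℝ-Solver

unitℚ : ∀ {n} → Fin n → Vector ℚ n
unitℚ zero    = 1ℚ ∷ λ _ → 0ℚ
unitℚ (suc i) = 0ℚ ∷ unitℚ i

⟪unitℚ⟫ : ∀ {n} i (x : Vector ℝ n) → ⟪ unitℚ i ⟫ x ≈ x i
⟪unitℚ⟫ zero x = ≈-trans (+-congˡ (∑-zero _ (λ j → zeroˡ (x (suc j)))))
  (solve 1 (λ x → con 1ℚ :* x :+ con 0ℚ := x) ≈-refl (x zero))
  where open ℝ-Solver
⟪unitℚ⟫ (suc i) x = ≈-trans (+-congˡ (⟪unitℚ⟫ i (tail x)))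
  (solve 2 (λ x y → con 0ℚ :* x :+ y := y) ≈-refl (x zero) (x (suc i)))
  where open ℝ-Solver

Solutions : ∀ {n} → List (Vector ℚ n) → Pred (Vector ℝ n) 0ℓ
Solutions es x = All (λ q → ⟪ q ⟫ x ≈ 0#) es

module _ {n} (es : List (Vector ℚ (suc n))) where

  vanishing-heads : All (λ q → head q ≡ 0ℚ) es → Solutions es ≅ Cylinder (Solutions (List.map tail es))
  vanishing-heads h = ⇔⇒≅
    (λ {x} sol → All.map⁺ (All.zipWith (λ {q} (q₀ , e) → ≈-trans (≈-sym (drop q x q₀)) e) (h , sol)))
    (λ {x} sol → All.zipWith (λ {q} (q₀ , e) → ≈-trans (drop q x q₀) e) (h , All.map⁻ sol))
    where
    drop : ∀ q x → head q ≡ 0ℚ → ⟪ q ⟫ x ≈ ⟪ tail q ⟫ (tail x)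
    drop q x q₀ = ≈-trans (+-congʳ _ (*-congʳ (head x) (fromℚ-cong q₀)))
      (solve 2 (λ x s → con 0ℚ :* x :+ s := s) ≈-refl (head x) (⟪ tail q ⟫ (tail x)))
      where open ℝ-Solver

  module Pivot (q : Vector ℚ (suc n)) (q∈es : q List.∈ es) (q₀≢0 : head q ≢ 0ℚ) where

    instance
      q₀-nonZero : ℚ.NonZero (head q)
      q₀-nonZero = ℚ.≢-nonZero q₀≢0

    -- The equation q solved for the first coordinate.
    w : Vector ℚ n
    w i = ℚ.- (ℚ.1/ head q) ℚ.* q (suc i)

    substituted : Vector ℚ (suc n) → Vector ℚ n
    substituted r i = r (suc i) ℚ.+ head r ℚ.* w i

    ⟪substituted⟫ : ∀ r (x : Vector ℝ (suc n)) → head x ≈ ⟪ w ⟫ (tail x) →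
                    ⟪ substituted r ⟫ (tail x) ≈ ⟪ r ⟫ x
    ⟪substituted⟫ r x h = ≈-trans (⟪⟫-+* (tail r) w (head r) (tail x))
      (≈-trans (+-comm _ _) (+-congʳ _ (*-congˡ (≈-sym h))))

    inverse : fromℚ (ℚ.1/ head q) R.* fromℚ (head q) ≈ 1#
    inverse = ≈-trans (≈-sym (fromℚ-* _ _)) (fromℚ-cong (ℚ.*-inverseˡ (head q)))

    ⟪w⟫ : ∀ (x : Vector ℝ n) → ⟪ w ⟫ x ≈ R.- (fromℚ (ℚ.1/ head q)) R.* ⟪ tail q ⟫ x
    ⟪w⟫ x = ≈-trans
      (sum-cong-≋ (λ i → ≈-trans
        (*-congʳ (x i) (≈-trans (fromℚ-* (ℚ.- (ℚ.1/ head q)) (q (suc i))) (*-congʳ _ (fromℚ-neg (ℚ.1/ head q)))))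
        (*-assoc _ _ _)))
      (≈-sym (*-distribˡ-sum (R.- (fromℚ (ℚ.1/ head q))) (λ i → fromℚ (q (suc i)) R.* x i)))

    solved : ∀ (x : Vector ℝ (suc n)) → ⟪ q ⟫ x ≈ 0# → head x ≈ ⟪ w ⟫ (tail x)
    solved x h = begin
      head x                        ≈⟨ *-identityˡ (head x) ⟨
      1# R.* head x                 ≈⟨ *-congʳ (head x) inverse ⟨
      r R.* q₀ R.* head x
        ≈⟨ solve 4 (λ r q x s → r :* q :* x := r :* (q :* x :+ s) :+ (:- r) :* s) ≈-refl r q₀ (head x) s ⟩
      r R.* ⟪ q ⟫ x R.+ R.- r R.* s   ≈⟨ +-congʳ _ (*-congˡ h) ⟩
      r R.* 0# R.+ R.- r R.* s        ≈⟨ solve 2 (λ r s → r :* con 0ℚ :+ s := s) ≈-refl r (R.- r R.* s) ⟩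
      R.- r R.* s                     ≈⟨ ⟪w⟫ (tail x) ⟨
      ⟪ w ⟫ (tail x)                ∎
      where
      open ℝ-Solver
      open SetoidReasoning setoid
      r  = fromℚ (ℚ.1/ head q)
      q₀ = fromℚ (head q)
      s  = ⟪ tail q ⟫ (tail x)

    -- The pivot equation may stay in the list: substituted into itself, it has only zero
    -- coefficients.
    eliminate : Solutions es ≅ Solutions (List.map substituted es)
    eliminate = record
      { to = tail ; from = λ x → ⟪ w ⟫ x ∷ x
      ; to-linear = coordinate-linear ∘ suc
      ; from-linear = λ { zero → ⟪⟫-linear w ; (suc i) → coordinate-linear i }
      ; to-∈ = λ {x} sol → All.map⁺ (All.map (λ {r} → ≈-trans (⟪substituted⟫ r x (pivot x sol))) sol)
      ; from-∈ = λ {y} sol → All.map (λ {r} → ≈-trans (≈-sym (⟪substituted⟫ r (⟪ w ⟫ y ∷ y) ≈-refl))) (All.map⁻ sol)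
      ; from-to = λ { {x} sol zero → ≈-sym (pivot x sol) ; sol (suc i) → ≈-refl }
      ; to-from = λ _ _ → ≈-refl }
      where
      pivot : ∀ x → x ∈ Solutions es → head x ≈ ⟪ w ⟫ (tail x)
      pivot x sol = solved x (All.lookup sol q∈es)

-- The recursion is on the number of unknowns. An unknown that has a pivot is eliminated; one that
-- occurs in no equation is free and adds 1 to `d`.
Solutions-≅ : ∀ n (es : List (Vector ℚ n)) → ∃[ d ] (Solutions es ≅ Everything d)
Solutions-≅ zero es = 0 , ⇔⇒≅ (λ _ → tt) (λ _ → All.universal (λ _ → ≈-refl) es)
Solutions-≅ (suc n) es with All.all? (λ q → head q ℚ.≟ 0ℚ) es
... | yes h = let d , I = Solutions-≅ n (List.map tail es)
              in suc d , ≅-trans (vanishing-heads es h) (Cylinder-≅ I)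
... | no ¬h = let q , q∈es , q₀≢0 = find (All.¬All⇒Any¬ (λ q → head q ℚ.≟ 0ℚ) es ¬h)
                  d , I = Solutions-≅ n _
              in d , ≅-trans (Pivot.eliminate es q q∈es q₀≢0) I
-- Affine bases

basis : ∀ {n} → Fin n → Vector ℝ n
basis zero    = 1# ∷ λ _ → 0#
basis (suc j) = 0# ∷ basis j

combination-basis : ∀ {n} (c : Vector ℝ n) → combination c basis ≋ c
combination-basis c zero = ≈-trans
  (+-congˡ (∑-zero _ (λ j → zeroʳ (c (suc j)))))
  (solve 1 (λ c → c :* con 1ℚ :+ con 0ℚ := c) ≈-refl (c zero))
  where open ℝ-Solver
combination-basis c (suc i) = ≈-trans (+-congˡ (combination-basis (tail c) i))
  (solve 2 (λ c d → c :* con 0ℚ :+ d := d) ≈-refl (c zero) (c (suc i)))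
  where open ℝ-Solver

simplex : ∀ {n} → Vector (Vector ℝ n) (suc n)
simplex = (λ _ → 0#) ∷ basis

combination-simplex : ∀ {n} (c : Vector ℝ (suc n)) → combination c simplex ≋ tail c
combination-simplex c i = ≈-trans (+-cong (zeroʳ (head c)) (combination-basis (tail c) i)) (+-identityˡ _)

simplex-AffineBasis : ∀ n → AffineBasis (Everything n) simplex
simplex-AffineBasis n = record
  { members = λ _ → tt
  ; independent = independent
  ; spanning = λ x _ → (1# R.- ∑ x) ∷ x
      , solve 1 (λ s → (con 1ℚ :- s) :+ s := con 1ℚ) ≈-refl (∑ x)
      , λ i → ≈-sym (combination-simplex ((1# R.- ∑ x) ∷ x) i) }
  where
  open ℝ-Solver
  independent : AffinelyIndependent (simplex {n})
  independent c ∑c h (suc j) = ≈-trans (≈-sym (combination-simplex c j)) (h j)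
  -- The origin contributes nothing to a combination, so its coefficient is found from the sum of
  -- all coefficients instead.
  independent c ∑c h zero = ≈-trans (≈-sym (+-identityʳ _))
    (≈-trans (+-congˡ (≈-sym (∑-zero _ (λ j → independent c ∑c h (suc j))))) ∑c)

-- Linear maps preserve the coefficients of a combination, so the conditions on their sum carry over
-- unchanged.
AffineBasis-≅ : ∀ {k m n} {P : Pred (Vector ℝ m) 0ℓ} {Q : Pred (Vector ℝ n) 0ℓ} {v : Vector (Vector ℝ n) k} →
                (I : P ≅ Q) → AffineBasis Q v → AffineBasis P (_≅_.from I ∘ v)
AffineBasis-≅ {Q = Q} {v} I B = record
  { members = λ j → I.from-∈ (B.members j)
  ; independent = λ c ∑c h → B.independent c ∑c (λ i → ≈-trans
      (≈-trans (≈-sym (combination-cong c (λ j → I.to-from (B.members j)) i)) (≈-sym (homo (I.to-linear i) c _)))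
      -- The zero vector is the empty combination, hence `to` sends it to 0.
      (≈-trans (resp (I.to-linear i) h) (homo (I.to-linear i) {0} (λ ()) (λ ()))))
  ; spanning = λ x x∈P → let c , ∑c , e = B.spanning (I.to x) (I.to-∈ x∈P) in
      c , ∑c , λ i → ≈-trans (≈-sym (I.from-to x∈P i))
        (≈-trans (resp (I.from-linear i) e) (homo (I.from-linear i) c v)) }
  where
  module I = _≅_ I
  module B = AffineBasis B

HasDim-≅ : ∀ {n d} (X : Pred (Vector ℝ n) 0ℓ) → AffineSpan X ≅ Everything d → HasDim X d
HasDim-≅ {d = d} X I = _ , AffineBasis-≅ I (simplex-AffineBasis d)

-- Residue classes and Apéry sets

infix 4 _∼_[mod_]

-- A form of congruence without subtraction.
_∼_[mod_] : ℕ → ℕ → ℕ → Set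
a ∼ b [mod m ] = ∃[ k ] ∃[ l ] a ℕ.+ k * m ≡ b ℕ.+ l * m

module _ {m : ℕ} where

  ≡⇒∼ : ∀ {a b} → a ≡ b → a ∼ b [mod m ]
  ≡⇒∼ refl = 0 , 0 , refl

  ∼-refl : ∀ {a} → a ∼ a [mod m ]
  ∼-refl = ≡⇒∼ refl

  ∼-sym : ∀ {a b} → a ∼ b [mod m ] → b ∼ a [mod m ]
  ∼-sym (k , l , e) = l , k , sym e

  ∼-trans : ∀ {a b c} → a ∼ b [mod m ] → b ∼ c [mod m ] → a ∼ c [mod m ]
  ∼-trans {a} {b} {c} (k , l , e) (k′ , l′ , e′) = k ℕ.+ k′ , l ℕ.+ l′ , (begin
    a ℕ.+ (k ℕ.+ k′) * m          ≡⟨ split a k k′ m ⟩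
    (a ℕ.+ k * m) ℕ.+ k′ * m      ≡⟨ cong (ℕ._+ k′ * m) e ⟩
    (b ℕ.+ l * m) ℕ.+ k′ * m      ≡⟨ swap b l k′ m ⟩
    (b ℕ.+ k′ * m) ℕ.+ l * m      ≡⟨ cong (ℕ._+ l * m) e′ ⟩
    (c ℕ.+ l′ * m) ℕ.+ l * m      ≡⟨ swap c l′ l m ⟩
    (c ℕ.+ l * m) ℕ.+ l′ * m      ≡⟨ split c l l′ m ⟨
    c ℕ.+ (l ℕ.+ l′) * m          ∎)
    where
    open ≡-Reasoning
    open +-*-Solver
    split : ∀ a k k′ m → a ℕ.+ (k ℕ.+ k′) * m ≡ (a ℕ.+ k * m) ℕ.+ k′ * m
    split = solve 4 (λ a k k′ m → a :+ (k :+ k′) :* m := (a :+ k :* m) :+ k′ :* m) refl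
    swap : ∀ a k k′ m → (a ℕ.+ k * m) ℕ.+ k′ * m ≡ (a ℕ.+ k′ * m) ℕ.+ k * m
    swap = solve 4 (λ a k k′ m → (a :+ k :* m) :+ k′ :* m := (a :+ k′ :* m) :+ k :* m) refl

  ∼-+ : ∀ {a b c d} → a ∼ b [mod m ] → c ∼ d [mod m ] → a ℕ.+ c ∼ b ℕ.+ d [mod m ]
  ∼-+ {a} {b} {c} {d} (k , l , e) (k′ , l′ , e′) =
    k ℕ.+ k′ , l ℕ.+ l′ , trans (split a c k k′ m) (trans (cong₂ ℕ._+_ e e′) (sym (split b d l l′ m)))
    where
    open +-*-Solver
    split : ∀ a c k k′ m → (a ℕ.+ c) ℕ.+ (k ℕ.+ k′) * m ≡ (a ℕ.+ k * m) ℕ.+ (c ℕ.+ k′ * m)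
    split = solve 5 (λ a c k k′ m → (a :+ c) :+ (k :+ k′) :* m := (a :+ k :* m) :+ (c :+ k′ :* m)) refl

  ∼-*ˡ : ∀ c {a b} → a ∼ b [mod m ] → c * a ∼ c * b [mod m ]
  ∼-*ˡ zero    e = ∼-refl
  ∼-*ˡ (suc c) e = ∼-+ e (∼-*ˡ c e)

  +*∼ : ∀ a k → a ℕ.+ k * m ∼ a [mod m ]
  +*∼ a k = 0 , k , ℕ.+-identityʳ _

  -- As `a` is the smaller number, more multiples of `m` were added to it than to `b`. One `m` is
  -- split off so that `b - m` is visibly `a` plus a multiple of `m`, which is what the Apéry
  -- condition speaks about.
  ∼∧<⇒+ : ∀ {a b} → a ∼ b [mod m ] → a < b → ∃[ q ] b ≡ m ℕ.+ (a ℕ.+ q * m)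
  ∼∧<⇒+ {a} {b} (k , l , e) a<b = q , (begin
    b                                   ≡⟨ ℕ.+-cancelʳ-≡ (l * m) _ _ (begin
       b ℕ.+ l * m                        ≡⟨ e ⟨
       a ℕ.+ k * m                        ≡⟨ cong (λ k → a ℕ.+ k * m) (sym (ℕ.m+[n∸m]≡n l<k)) ⟩
       a ℕ.+ (suc l ℕ.+ q) * m            ≡⟨ rearrange a l q m ⟩
       (m ℕ.+ (a ℕ.+ q * m)) ℕ.+ l * m    ∎) ⟩
    m ℕ.+ (a ℕ.+ q * m)                 ∎)
    where
    open ≡-Reasoning
    open +-*-Solver
    l<k : l < k
    l<k = ℕ.≰⇒> λ k≤l → ℕ.<⇒≢ (ℕ.+-mono-<-≤ a<b (ℕ.*-monoˡ-≤ m k≤l)) e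
    q = k ℕ.∸ suc l
    rearrange : ∀ a l q m → a ℕ.+ (suc l ℕ.+ q) * m ≡ (m ℕ.+ (a ℕ.+ q * m)) ℕ.+ l * m
    rearrange = solve 4 (λ a l q m → a :+ (con 1 :+ l :+ q) :* m := (m :+ (a :+ q :* m)) :+ l :* m) refl

  [mod]⇒∼ : ∀ a b → a ≡ b [mod m ] → a ∼ b [mod m ]
  [mod]⇒∼ a b (ℕ.divides q e) with ℕ.≤-total a b
  ... | inj₁ a≤b = q , 0 , trans (cong (a ℕ.+_) (trans (sym e) (ℕ.m≤n⇒∣m-n∣≡n∸m a≤b)))
                             (trans (ℕ.m+[n∸m]≡n a≤b) (sym (ℕ.+-identityʳ b)))
  ... | inj₂ b≤a = 0 , q , trans (ℕ.+-identityʳ a) (trans (sym (ℕ.m+[n∸m]≡n b≤a))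
                             (cong (b ℕ.+_) (trans (sym (ℕ.m≤n⇒∣n-m∣≡n∸m b≤a)) e)))

  ∼∧≤⇒∣ : ∀ {a b} → a ∼ b [mod m ] → a ≤ b → m ℕ.∣ b ℕ.∸ a
  ∼∧≤⇒∣ {a} {b} (k , l , e) a≤b = ℕ.∣m+n∣m⇒∣n
    (ℕ.divides k (ℕ.+-cancelˡ-≡ a _ _ (trans
      (trans (swap a (l * m) (b ℕ.∸ a)) (cong (ℕ._+ l * m) (ℕ.m+[n∸m]≡n a≤b))) (sym e))))
    (ℕ.n∣m*n l)
    where
    open +-*-Solver
    swap : ∀ a c d → a ℕ.+ (c ℕ.+ d) ≡ (a ℕ.+ d) ℕ.+ c
    swap = solve 3 (λ a c d → a :+ (c :+ d) := (a :+ d) :+ c) refl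

  ∼⇒[mod] : ∀ {a b} → a ∼ b [mod m ] → a ≡ b [mod m ]
  ∼⇒[mod] {a} {b} e with ℕ.≤-total a b
  ... | inj₁ a≤b = subst (m ℕ.∣_) (sym (ℕ.m≤n⇒∣m-n∣≡n∸m a≤b)) (∼∧≤⇒∣ e a≤b)
  ... | inj₂ b≤a = subst (m ℕ.∣_) (sym (ℕ.m≤n⇒∣n-m∣≡n∸m b≤a)) (∼∧≤⇒∣ (∼-sym e) b≤a)

scale-∼ : ∀ c {m a b} → a ∼ b [mod m ] → c * a ∼ c * b [mod c * m ]
scale-∼ c {m} {a} {b} (k , l , e) = k , l , trans (factor c a k m) (trans (cong (c *_) e) (sym (factor c b l m)))
  where
  open +-*-Solver
  factor : ∀ c a k m → c * a ℕ.+ k * (c * m) ≡ c * (a ℕ.+ k * m)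
  factor = solve 4 (λ c a k m → c :* a :+ k :* (c :* m) := c :* (a :+ k :* m)) refl

unscale-∼ : ∀ c .{{_ : ℕ.NonZero c}} {m a b} → c * a ∼ c * b [mod c * m ] → a ∼ b [mod m ]
unscale-∼ c {m} {a} {b} (k , l , e) =
  k , l , ℕ.*-cancelˡ-≡ _ _ c (trans (sym (factor c a k m)) (trans e (factor c b l m)))
  where
  open +-*-Solver
  factor : ∀ c a k m → c * a ℕ.+ k * (c * m) ≡ c * (a ℕ.+ k * m)
  factor = solve 4 (λ c a k m → c :* a :+ k :* (c :* m) := c :* (a :+ k :* m)) refl

∼-weaken : ∀ c {m a b} → a ∼ b [mod c * m ] → a ∼ b [mod c ]
∼-weaken c {m} {a} {b} (k , l , e) =
  k * m , l * m , trans (cong (a ℕ.+_) (factor k m c)) (trans e (cong (b ℕ.+_) (sym (factor l m c))))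
  where
  open +-*-Solver
  factor : ∀ k m c → k * m * c ≡ k * (c * m)
  factor = solve 3 (λ k m c → k :* m :* c := k :* (c :* m)) refl

∼∧<⇒≡ : ∀ {m a b} → a ∼ b [mod m ] → a < m → b < m → a ≡ b
∼∧<⇒≡ {m} {a} {b} e a<m b<m with ℕ.<-cmp a b
... | tri≈ _ a≡b _ = a≡b
... | tri< a<b _ _ = let q , eq = ∼∧<⇒+ e a<b in
  contradiction (ℕ.≤-trans (ℕ.m≤m+n m _) (ℕ.≤-reflexive (sym eq))) (ℕ.<⇒≱ b<m)
... | tri> _ _ b<a = let q , eq = ∼∧<⇒+ (∼-sym e) b<a in
  contradiction (ℕ.≤-trans (ℕ.m≤m+n m _) (ℕ.≤-reflexive (sym eq))) (ℕ.<⇒≱ a<m)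

∼-cancelʳ : ∀ {m a b} c → a ℕ.+ c ∼ b ℕ.+ c [mod m ] → a ∼ b [mod m ]
∼-cancelʳ {m} {a} {b} c (k , l , e) =
  k , l , ℕ.+-cancelʳ-≡ c _ _ (trans (swap a c (k * m)) (trans e (sym (swap b c (l * m)))))
  where
  open +-*-Solver
  swap : ∀ a c d → a ℕ.+ d ℕ.+ c ≡ a ℕ.+ c ℕ.+ d
  swap = solve 3 (λ a c d → a :+ d :+ c := a :+ c :+ d) refl

inverse-mod : ∀ α c → gcd α (suc c) ≡ 1 → ∃[ α⁻¹ ] α * α⁻¹ ∼ 1 [mod suc c ]
inverse-mod α c coprime with Coprimality.coprime-Bézout (Coprimality.gcd≡1⇒coprime {α} {suc c} coprime)
... | Bézout.+- x y e = x , 0 , y , trans (ℕ.+-identityʳ _) (trans (ℕ.*-comm α x) (sym e))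
-- Here `1 + xα` is a multiple of the modulus, so the inverse is `-x`, and `xc` represents it modulo
-- `c + 1`.
... | Bézout.-+ x y e = x * c , y , x * α , trans (cong (α * (x * c) ℕ.+_) (sym e)) (rearrange α x c)
  where
  open +-*-Solver
  rearrange : ∀ α x c → α * (x * c) ℕ.+ (1 ℕ.+ x * α) ≡ 1 ℕ.+ (x * α) * suc c
  rearrange = solve 3 (λ α x c → α :* (x :* c) :+ (con 1 :+ x :* α) := con 1 :+ (x :* α) :* (con 1 :+ c)) refl

module _ {p : ℕ} where

  %∼ : ∀ n → n ℕ.% suc p ∼ n [mod suc p ]
  %∼ n = n ℕ./ suc p , 0 , trans (sym (ℕ.m≡m%n+[m/n]*n n (suc p))) (sym (ℕ.+-identityʳ n))

  opaque

    class : ℕ → Fin (suc p)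
    class n = n ℕ.mod suc p

    class-0 : class 0 ≡ zero
    class-0 = refl

    toℕ-class : ∀ n → toℕ (class n) ∼ n [mod suc p ]
    toℕ-class n = ∼-trans (≡⇒∼ (Fin.toℕ-fromℕ< (ℕ.m%n<n n (suc p)))) (%∼ n)

  class-cong : ∀ {a b} → a ∼ b [mod suc p ] → class a ≡ class b
  class-cong {a} {b} e = Fin.toℕ-injective
    (∼∧<⇒≡ (∼-trans (toℕ-class a) (∼-trans e (∼-sym (toℕ-class b)))) (Fin.toℕ<n _) (Fin.toℕ<n _))

  class-residue : ∀ (i : Fin p) → class (residue i) ≡ suc i
  class-residue i = Fin.toℕ-injective
    (∼∧<⇒≡ (toℕ-class (residue i)) (Fin.toℕ<n _) (ℕ.s≤s (Fin.toℕ<n i)))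

  residue-cases : ∀ n → n ∼ 0 [mod suc p ] ⊎ ∃[ i ] n ∼ residue {p} i [mod suc p ]
  residue-cases n with class n | toℕ-class n
  ... | zero  | e = inj₁ (∼-sym e)
  ... | suc i | e = inj₂ (i , ∼-sym e)

  residue≁0 : ∀ (i : Fin p) {n} → n ∼ residue i [mod suc p ] → n ≢ 0
  residue≁0 i e refl with ∼∧<⇒≡ e (ℕ.s≤s ℕ.z≤n) (ℕ.s≤s (Fin.toℕ<n i))
  ... | ()

  module _ {A : Set} (z : A) where

    -- z is the value at the residue 0, which has no coordinate in a tuple.
    periodic : Vector A p → ℕ → A
    periodic x n = (z ∷ x) (class n)

    periodic-cong : ∀ x {m n} → m ∼ n [mod suc p ] → periodic x m ≡ periodic x n
    periodic-cong x e = cong (z ∷ x) (class-cong e)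

    periodic-0 : ∀ x {n} → n ∼ 0 [mod suc p ] → periodic x n ≡ z
    periodic-0 x e = cong (z ∷ x) (trans (class-cong e) class-0)

    periodic-residue : ∀ x {n} i → n ∼ residue i [mod suc p ] → periodic x n ≡ x i
    periodic-residue x i e = cong (z ∷ x) (trans (class-cong e) (class-residue i))

-- The Apéry set as a function on all natural numbers: `f n` is the least element of `S` in the
-- class of `n`. The class of 0 is included, so sums of residues need no case distinction.
record AperyFunction (S : Pred ℕ 0ℓ) (m : ℕ) (f : ℕ → ℕ) : Set where
  field
    member    : ∀ n → f n ∈ S
    congruent : ∀ n → f n ∼ n [mod m ]
    least     : ∀ {n s} → s ∈ S → s ∼ n [mod m ] → f n ≤ s

  unique : ∀ {n s} → s ∈ S → s ∼ n [mod m ] → (∀ {t} → t ∈ S → t ∼ n [mod m ] → s ≤ t) → f n ≡ s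
  unique s∈S s∼n s-least = ℕ.≤-antisym (least s∈S s∼n) (s-least (member _) (congruent _))

  respects : ∀ {n n′} → n ∼ n′ [mod m ] → f n ≡ f n′
  respects {n} {n′} e = unique (member n′) (∼-trans (congruent n′) (∼-sym e))
    (λ t∈S t∼n → least t∈S (∼-trans t∼n e))

  module _ (S+S⊆S : ∀ {s t} → s ∈ S → t ∈ S → (s ℕ.+ t) ∈ S) where

    subadditive : ∀ n n′ → f (n ℕ.+ n′) ≤ f n ℕ.+ f n′
    subadditive n n′ = least (S+S⊆S (member n) (member n′)) (∼-+ (congruent n) (congruent n′))

  -- An element of the class above `f n` exceeds it by a positive multiple of `m`, so subtracting
  -- `m` once does not leave `S`.
  Ap⇔ : ∀ {n} → 0 < m → (∀ {s} → s ∈ S → ∀ q → (s ℕ.+ q * m) ∈ S) → n ∈ S →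
        (n ∈ Ap S m → n ≡ f n) × (n ≡ f n → n ∈ Ap S m)
  Ap⇔ {n} 0<m S+m⊆S n∈S = minimal , λ n≡fn → n∈S , λ (m≤n , n∸m∈S) →
      ℕ.<⇒≱ (ℕ.∸-monoʳ-< 0<m m≤n)
        (subst (_≤ n ℕ.∸ m) (sym n≡fn) (least n∸m∈S (0∸ m≤n)))
    where
    0∸ : m ≤ n → n ℕ.∸ m ∼ n [mod m ]
    0∸ m≤n = 1 , 0 , trans (cong (n ℕ.∸ m ℕ.+_) (ℕ.*-identityˡ m)) (trans (ℕ.m∸n+n≡m m≤n) (sym (ℕ.+-identityʳ n)))
    minimal : n ∈ Ap S m → n ≡ f n
    minimal (_ , n∸m∉S) with ℕ.m≤n⇒m<n∨m≡n (least n∈S ∼-refl)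
    ... | inj₂ fn≡n = sym fn≡n
    ... | inj₁ fn<n = let q , e = ∼∧<⇒+ (congruent n) fn<n in contradiction
      ( subst (m ≤_) (sym e) (ℕ.m≤m+n m _)
      , subst (_∈ S) (sym (trans (cong (ℕ._∸ m) e) (ℕ.m+n∸m≡n m _))) (S+m⊆S (member n) q)) n∸m∉S

IsAperyTuple⇒AperyFunction : ∀ {S p} {a : Vector ℕ p} → 0 ∈ S →
  (∀ {s} → s ∈ S → ∀ q → (s ℕ.+ q * suc p) ∈ S) →
  IsAperyTuple S (suc p) a → AperyFunction S (suc p) (periodic 0 a)
IsAperyTuple⇒AperyFunction {S} {p} {a} 0∈S S+m⊆S apery = record
  { member = member ; congruent = congruent ; least = λ {n} → least n }
  where
  member : ∀ n → periodic 0 a n ∈ S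
  member n with residue-cases n
  ... | inj₁ e       = subst (_∈ S) (sym (periodic-0 0 a e)) 0∈S
  ... | inj₂ (i , e) = subst (_∈ S) (sym (periodic-residue 0 a i e)) (proj₁ (proj₁ (apery i)))
  congruent : ∀ n → periodic 0 a n ∼ n [mod suc p ]
  congruent n with residue-cases n
  ... | inj₁ e       = ∼-trans (≡⇒∼ (periodic-0 0 a e)) (∼-sym e)
  ... | inj₂ (i , e) = ∼-trans (≡⇒∼ (periodic-residue 0 a i e))
                         (∼-trans ([mod]⇒∼ _ _ (proj₂ (apery i))) (∼-sym e))
  least : ∀ n {s} → s ∈ S → s ∼ n [mod suc p ] → periodic 0 a n ≤ s
  least n {s} s∈S s∼n with residue-cases n
  ... | inj₁ e       = subst (_≤ s) (sym (periodic-0 0 a e)) ℕ.z≤n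
  -- An element `s` below `aᵢ` in the same class would put `aᵢ - (p + 1)` into `S`, as `s` plus a
  -- multiple of `p + 1`.
  ... | inj₂ (i , e) = subst (_≤ s) (sym (periodic-residue 0 a i e)) (ℕ.≮⇒≥ λ s<aᵢ →
    let q , eq = ∼∧<⇒+ (∼-trans s∼n (∼-trans e (∼-sym ([mod]⇒∼ _ _ (proj₂ (apery i)))))) s<aᵢ
    in proj₂ (proj₁ (apery i))
         ( subst (suc p ≤_) (sym eq) (ℕ.m≤m+n (suc p) _)
         , subst (_∈ S) (sym (trans (cong (ℕ._∸ suc p) eq) (ℕ.m+n∸m≡n (suc p) _))) (S+m⊆S s∈S q)))

-- The affine span of a face

-- This is `V(a)`. As the entries of `a` are natural numbers, it is decidable which equations define
-- it.
Tight : ∀ m → Vector ℕ (ℕ.pred m) → Pred (Point m) 0ℓ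
Tight m a x = ∀ i j k → Adds m i j k → a i ℕ.+ a j ≡ a k → x i R.+ x j ≈ x k

Tight-combination : ∀ {m a k} (c : Vector ℝ k) (v : Vector (Point m) k) →
                    (∀ j → v j ∈ Tight m a) → combination c v ∈ Tight m a
Tight-combination c v tight i j k ijk aᵢ+aⱼ≡aₖ =
  forms-agree (+-linear (coordinate-linear i) (coordinate-linear j)) (coordinate-linear k) c v
    (λ l → tight l i j k ijk aᵢ+aⱼ≡aₖ)

Tight-resp : ∀ {m a x y} → x ≋ y → y ∈ Tight m a → x ∈ Tight m a
Tight-resp x≋y tight i j k ijk aᵢ+aⱼ≡aₖ =
  ≈-trans (+-cong (x≋y i) (x≋y j)) (≈-trans (tight i j k ijk aᵢ+aⱼ≡aₖ) (≈-sym (x≋y k)))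

module _ {m} {F : Pred (Point m) 0ℓ} (isFace : IsFace m F) {a : Vector ℕ (ℕ.pred m)}
         (a∈relint : (λ i → fromℕ (a i)) ∈ RelativeInterior F) where

  private
    A : Point m
    A i = fromℕ (a i)
    A∈F : A ∈ F
    A∈F = proj₁ a∈relint
    module Face x = Equivalence (proj₂ isFace x)

    A-tight : ∀ {i j k} → a i ℕ.+ a j ≡ a k → A i R.+ A j ≈ A k
    A-tight {i} {j} e = ≈-trans (≈-sym (fromℕ-+ (a i) (a j))) (fromℚ-cong (cong (λ n → + n ℚ./ 1) e))

  -- A moves within F in the direction A - x as well as towards x, so an
  -- inequality which is tight at A cannot be slack at x.
  face⊆Tight : ∀ {x} → x ∈ F → x ∈ Tight m a
  face⊆Tight {x} x∈F i j k ijk aᵢ+aⱼ≡aₖ =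
    let ε , 0<ε , ball⊆F = proj₂ a∈relint
        -- Half of `η` bounds the movement away from `A`; the other half makes the inequalities of
        -- the ball strict.
        η , 0<η , η≤ε = 0<⇒fromℚ≤ 0<ε
        t , T , 0<T , Tt≈1 , bound = scaled-bounds (λ l → A l R.- x l) (½*-pos 0<η)
        τ = fromℚ t
        -- The point `A + τ(A - x)`, spelled as the sum to which `combination` unfolds, with its
        -- final 0, so that it lies in the affine span by reflexivity.
        y : Point m
        y l = (1# R.+ τ) R.* A l R.+ (R.- τ R.* x l R.+ 0#)
        ½η = fromℚ (ℚ.½ ℚ.* η)
        2·½η : ½η R.+ ½η R.≤ ε
        2·½η = ≤-respˡ-≈ η≤ε (≈-trans (fromℚ-cong (sym (½*+½* η))) (fromℚ-+ _ _))
        close : ∀ l → A l R.- ε R.< y l × y l R.< A l R.+ ε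
        close l =
            ≤∧0<⇒< (½*-pos 0<η) (≤-shift (+-mono-≤ (proj₁ (bound l)) 2·½η)
              (solve 5 (λ A ε h τ x →
                  (τ :* (A :- x) :+ ε) :- (:- h :+ (h :+ h)) :=
                  ((con 1ℚ :+ τ) :* A :+ (:- τ :* x :+ con 0ℚ)) :- ((A :- ε) :+ h)) ≈-refl
                (A l) ε ½η τ (x l)))
          , ≤∧0<⇒< (½*-pos 0<η) (≤-shift (+-mono-≤ (proj₂ (bound l)) 2·½η)
              (solve 5 (λ A ε h τ x →
                  (h :+ ε) :- (τ :* (A :- x) :+ (h :+ h)) :=
                  (A :+ ε) :- (((con 1ℚ :+ τ) :* A :+ (:- τ :* x :+ con 0ℚ)) :+ h)) ≈-refl
                (A l) ε ½η τ (x l)))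
        y∈F = ball⊆F y
          ( 2 , (A ∷ x ∷ []) , ((1# R.+ τ) ∷ R.- τ ∷ [])
          , (λ { zero → A∈F ; (suc zero) → x∈F })
          , solve 1 (λ τ → (con 1ℚ :+ τ) :+ (:- τ :+ con 0ℚ) := con 1ℚ) ≈-refl τ
          , λ _ → ≈-refl ) close
        yₖ≤yᵢ+yⱼ = proj₁ (Face.to y y∈F) i j k ijk
        -- In the cone inequality at `y` the terms of `A` cancel by tightness, and those of `x`
        -- carry the factor `-τ`, which reverses the inequality.
        reversed : τ R.* (x i R.+ x j) R.≤ τ R.* x k
        reversed = ≤-shift yₖ≤yᵢ+yⱼ (≈-trans
          (solve 7 (λ τ Aᵢ Aⱼ Aₖ xᵢ xⱼ xₖ →
              (((con 1ℚ :+ τ) :* Aᵢ :+ (:- τ :* xᵢ :+ con 0ℚ)) :+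
               ((con 1ℚ :+ τ) :* Aⱼ :+ (:- τ :* xⱼ :+ con 0ℚ))) :-
               ((con 1ℚ :+ τ) :* Aₖ :+ (:- τ :* xₖ :+ con 0ℚ)) :=
              (con 1ℚ :+ τ) :* (Aᵢ :+ Aⱼ) :+ (τ :* xₖ :- τ :* (xᵢ :+ xⱼ) :- (con 1ℚ :+ τ) :* Aₖ))
            ≈-refl τ (A i) (A j) (A k) (x i) (x j) (x k))
          (≈-trans (+-congʳ _ (*-congˡ (A-tight aᵢ+aⱼ≡aₖ)))
            (solve 3 (λ s A r → s :* A :+ (r :- s :* A) := r) ≈-refl
              (1# R.+ τ) (A k) (τ R.* x k R.- τ R.* (x i R.+ x j)))))
        unscale : ∀ u → fromℚ T R.* (τ R.* u) ≈ u
        unscale u = ≈-trans (≈-sym (*-assoc (fromℚ T) τ u)) (≈-trans (*-congʳ u Tt≈1) (*-identityˡ u))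
    in ≤-antisym
         (≤-respˡ-≈ (≤-respʳ-≈ (fromℚ-*-mono-≤ 0<T reversed) (unscale _)) (unscale _))
         (proj₁ (Face.to x x∈F) i j k ijk)
    where open ℝ-Solver

  affineSpan⊆Tight : ∀ {x} → x ∈ AffineSpan F → x ∈ Tight m a
  affineSpan⊆Tight (_ , v , c , v∈F , _ , x≋) =
    Tight-resp {m} {a} x≋ (Tight-combination c v (λ j → face⊆Tight (v∈F j)))

  -- The inequalities which are not tight at A have slack at least 1 there,
  -- so a third of it in each coordinate may be spent on moving towards x.
  Tight⊆affineSpan : ∀ {x} → x ∈ Tight m a → x ∈ AffineSpan F
  Tight⊆affineSpan {x} tight =
    let t , T , 0<T , Tt≈1 , bound = scaled-bounds (λ l → x l R.- A l) {third} (ℚ.positive⁻¹ third)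
        τ = fromℚ t
        y : Point m
        y l = A l R.+ τ R.* (x l R.- A l)
        y-tight : ∀ {i j k} → Adds m i j k → a i ℕ.+ a j ≡ a k → y i R.+ y j ≈ y k
        y-tight {i} {j} {k} ijk e = ≈-trans
          (solve 5 (λ τ Aᵢ Aⱼ xᵢ xⱼ → (Aᵢ :+ τ :* (xᵢ :- Aᵢ)) :+ (Aⱼ :+ τ :* (xⱼ :- Aⱼ)) :=
                                      (Aᵢ :+ Aⱼ) :+ τ :* ((xᵢ :+ xⱼ) :- (Aᵢ :+ Aⱼ))) ≈-refl
            τ (A i) (A j) (x i) (x j))
          (+-cong (A-tight e) (*-congˡ (+-cong (tight i j k ijk e) (neg-cong (A-tight e)))))
        slack : ∀ {i j k} → suc (a k) ≤ a i ℕ.+ a j → y k R.≤ y i R.+ y j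
        slack {i} {j} {k} h = ≤-shift
          (+-mono-≤ (≤-respˡ-≈ (≤-respʳ-≈ (fromℕ-mono-≤ h) (fromℕ-+ (a i) (a j))) (fromℕ-+ 1 (a k)))
            (+-mono-≤ (proj₂ (bound k)) (+-mono-≤ (proj₁ (bound i)) (proj₁ (bound j)))))
          (solve 7 (λ τ Aᵢ Aⱼ Aₖ xᵢ xⱼ xₖ →
              ((Aᵢ :+ Aⱼ) :+ (con third :+ (τ :* (xᵢ :- Aᵢ) :+ τ :* (xⱼ :- Aⱼ)))) :-
              ((con 1ℚ :+ Aₖ) :+ (τ :* (xₖ :- Aₖ) :+ (:- con third :+ :- con third))) :=
              ((Aᵢ :+ τ :* (xᵢ :- Aᵢ)) :+ (Aⱼ :+ τ :* (xⱼ :- Aⱼ))) :- (Aₖ :+ τ :* (xₖ :- Aₖ)))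
            ≈-refl τ (A i) (A j) (A k) (x i) (x j) (x k))
        y∈cone : y ∈ GroupCone m
        y∈cone i j k ijk =
          -- At `A` the inequality holds between natural numbers, so it is either an equality or
          -- strict by at least 1.
          [ slack , (λ aₖ≡aᵢ+aⱼ → ≈⇒≤ (≈-sym (y-tight ijk (sym aₖ≡aᵢ+aⱼ)))) ]′
          (ℕ.m≤n⇒m<n∨m≡n (fromℕ-cancel-≤
            (≤-respʳ-≈ (proj₁ (Face.to A A∈F) i j k ijk) (≈-sym (fromℕ-+ (a i) (a j))))))
        -- Whatever equations `E` imposes, they hold at `A`, hence they are among the equations that
        -- `x`, and therefore `y`, satisfies.
        y∈F = Face.from y (y∈cone , λ i j k Eij ijk → y-tight ijk
          (fromℕ-injective (≈-trans (fromℕ-+ (a i) (a j)) (proj₂ (Face.to A A∈F) i j k Eij ijk))))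
    -- With `T = 1/τ`, the line from `A` through `y` reaches `x = (1 - T)A + Ty`; affine
    -- combinations allow `T > 1`.
    in 2 , (A ∷ y ∷ []) , ((1# R.- fromℚ T) ∷ fromℚ T ∷ [])
     , (λ { zero → A∈F ; (suc zero) → y∈F })
     , solve 1 (λ T → (con 1ℚ :- T) :+ (T :+ con 0ℚ) := con 1ℚ) ≈-refl (fromℚ T)
     , λ l → ≈-sym (≈-trans
         (solve 4 (λ T τ A x → (con 1ℚ :- T) :* A :+ (T :* (A :+ τ :* (x :- A)) :+ con 0ℚ) :=
                               (T :* τ) :* (x :- A) :+ A) ≈-refl (fromℚ T) τ (A l) (x l))
         (≈-trans (+-congʳ (A l) (*-congʳ _ Tt≈1))
           (solve 2 (λ A x → con 1ℚ :* (x :- A) :+ A := x) ≈-refl (A l) (x l))))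
    where
    open ℝ-Solver
    third : ℚ
    third = + 1 ℚ./ 3

  affineSpan≅Tight : AffineSpan F ≅ Tight m a
  affineSpan≅Tight = ⇔⇒≅ affineSpan⊆Tight Tight⊆affineSpan

-- The tight relations as a finite rational system

module _ (m : ℕ) (a : Vector ℕ (ℕ.pred m)) where

  Triple : Set
  Triple = Index m × Index m × Index m

  IsTight : Triple → Set
  IsTight (i , j , k) = Adds m i j k × a i ℕ.+ a j ≡ a k

  isTight? : ∀ s → Dec (IsTight s)
  isTight? (i , j , k) = (m ℕ.∣? _) ×-dec (a i ℕ.+ a j ℕ.≟ a k)

  -- Indices may coincide, so the row is a sum of unit vectors; the scalars 1 and -1 are written out
  -- to fit `⟪⟫-+*`.
  equation : Triple → Vector ℚ (ℕ.pred m)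
  equation (i , j , k) l = (unitℚ i l ℚ.+ 1ℚ ℚ.* unitℚ j l) ℚ.+ ℚ.- 1ℚ ℚ.* unitℚ k l

  ⟪equation⟫ : ∀ i j k x → ⟪ equation (i , j , k) ⟫ x ≈ (x i R.+ x j) R.- x k
  ⟪equation⟫ i j k x = ≈-trans (⟪⟫-+* _ (unitℚ k) (ℚ.- 1ℚ) x) (≈-trans
    (+-cong
      (≈-trans (⟪⟫-+* (unitℚ i) (unitℚ j) 1ℚ x) (+-cong (⟪unitℚ⟫ i x) (*-congˡ (⟪unitℚ⟫ j x))))
      (*-congˡ (⟪unitℚ⟫ k x)))
    (solve 3 (λ xᵢ xⱼ xₖ → (xᵢ :+ con 1ℚ :* xⱼ) :+ con (ℚ.- 1ℚ) :* xₖ := (xᵢ :+ xⱼ) :- xₖ) ≈-refl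
      (x i) (x j) (x k)))
    where open ℝ-Solver

  candidates triples : List Triple
  candidates = List.cartesianProduct indices (List.cartesianProduct indices indices)
    where indices = List.allFin (ℕ.pred m)
  triples = List.filter isTight? candidates

  Tight≅Solutions : Tight m a ≅ Solutions (List.map equation triples)
  Tight≅Solutions = ⇔⇒≅
    (λ {x} tight → All.map⁺ (All.map
      (λ { {i , j , k} (ijk , e) → ≈-trans (⟪equation⟫ i j k x)
             (≈-trans (+-congʳ _ (tight i j k ijk e)) (-‿inverseʳ (x k))) })
      (All.all-filter isTight? candidates)))
    (λ {x} sol i j k ijk e → difference (≈-trans (≈-sym (⟪equation⟫ i j k x))
      (All.lookup (All.map⁻ sol) (List.∈-filter⁺ isTight?
        (List.∈-cartesianProduct⁺ (List.∈-allFin i) (List.∈-cartesianProduct⁺ (List.∈-allFin j) (List.∈-allFin k)))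
        (ijk , e)))))
    where
    open ℝ-Solver
    difference : ∀ {u v} → u R.- v ≈ 0# → u ≈ v
    difference {u} {v} h = ≈-trans (solve 2 (λ u v → u := (u :- v) :+ v) ≈-refl u v)
      (≈-trans (+-congʳ v h) (+-identityˡ v))

  Tight≅ℝᵈ : ∃[ d ] (Tight m a ≅ Everything d)
  Tight≅ℝᵈ = let d , I = Solutions-≅ _ (List.map equation triples) in d , ≅-trans Tight≅Solutions I
-- Monoscopic gluing

module _ {p : ℕ} where

  periodic-linear : ∀ n → LinearForm (λ (x : Vector ℝ p) → periodic 0# x n)
  periodic-linear n = entry (class n)
    where
    entry : ∀ (i : Fin (suc p)) → LinearForm (λ (x : Vector ℝ p) → (0# ∷ x) i)
    entry zero    = 0-linear
    entry (suc i) = coordinate-linear i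

  periodic-tabulate : (f : ℕ → ℝ) → (∀ {m n} → m ∼ n [mod suc p ] → f m ≈ f n) → f 0 ≈ 0# →
                      ∀ n → periodic {p} 0# (f ∘ residue) n ≈ f n
  periodic-tabulate f f-cong f0 n with residue-cases {p} n
  ... | inj₁ e       = ≈-trans (≡⇒≈ (periodic-0 0# (f ∘ residue) e)) (≈-trans (≈-sym f0) (f-cong (∼-sym e)))
  ... | inj₂ (i , e) = ≈-trans (≡⇒≈ (periodic-residue 0# (f ∘ residue) i e)) (f-cong (∼-sym e))

  -- `Tight` with residues in place of indices, so that the arithmetic of nodes applies without
  -- first locating coordinates.
  TightPeriodic : Vector ℕ p → Pred (Vector ℝ p) 0ℓ
  TightPeriodic a x = ∀ m n → periodic 0 a m ℕ.+ periodic 0 a n ≡ periodic 0 a (m ℕ.+ n) →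
    periodic 0# x m R.+ periodic 0# x n ≈ periodic 0# x (m ℕ.+ n)

  module _ {S : Pred ℕ 0ℓ} {a : Vector ℕ p} (apery : AperyFunction S (suc p) (periodic 0 a)) where

    -- The new cases are those with residue 0. If `m` or `n` has it, the relation is trivial because
    -- the value there is 0. If only `m + n` has it, the hypothesis forces the Apéry element of `m`
    -- to be 0, which contradicts its nonzero residue.
    Tight⇒TightPeriodic : ∀ {x} → x ∈ Tight (suc p) a → x ∈ TightPeriodic a
    Tight⇒TightPeriodic {x} tight m n e with residue-cases m | residue-cases n | residue-cases (m ℕ.+ n)
    ... | inj₁ m∼0 | _ | _ = ≈-trans (+-congʳ _ (≡⇒≈ (periodic-0 0# x m∼0)))
          (≈-trans (+-identityˡ _) (≡⇒≈ (periodic-cong 0# x (∼-+ (∼-sym m∼0) ∼-refl))))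
    ... | inj₂ _ | inj₁ n∼0 | _ = ≈-trans (+-congˡ (≡⇒≈ (periodic-0 0# x n∼0)))
          (≈-trans (+-identityʳ _) (≡⇒≈ (periodic-cong 0# x
            (∼-trans (≡⇒∼ (sym (ℕ.+-identityʳ m))) (∼-+ ∼-refl (∼-sym n∼0))))))
    ... | inj₂ (i , m∼i) | inj₂ _ | inj₁ m+n∼0 = contradiction
          (ℕ.m+n≡0⇒m≡0 _ (trans e (periodic-0 0 a m+n∼0)))
          (residue≁0 i (∼-trans (AperyFunction.congruent apery m) m∼i))
    ... | inj₂ (i , m∼i) | inj₂ (j , n∼j) | inj₂ (k , m+n∼k) = ≈-trans
          (+-cong (≡⇒≈ (periodic-residue 0# x i m∼i)) (≡⇒≈ (periodic-residue 0# x j n∼j)))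
          (≈-trans (tight i j k (∼⇒[mod] (∼-trans (∼-+ (∼-sym m∼i) (∼-sym n∼j)) m+n∼k))
             (trans (cong₂ ℕ._+_ (sym (periodic-residue 0 a i m∼i)) (sym (periodic-residue 0 a j n∼j)))
               (trans e (periodic-residue 0 a k m+n∼k))))
            (≈-sym (≡⇒≈ (periodic-residue 0# x k m+n∼k))))

    TightPeriodic⇒Tight : ∀ {x} → x ∈ TightPeriodic a → x ∈ Tight (suc p) a
    TightPeriodic⇒Tight {x} tight i j k ijk e = ≈-trans
      (+-cong (≡⇒≈ (sym (periodic-residue 0# x i ∼-refl))) (≡⇒≈ (sym (periodic-residue 0# x j ∼-refl))))
      (≈-trans (tight (residue i) (residue j) (trans
          (cong₂ ℕ._+_ (periodic-residue 0 a i ∼-refl) (periodic-residue 0 a j ∼-refl))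
          (trans e (sym (periodic-residue 0 a k i+j∼k)))))
        (≡⇒≈ (periodic-residue 0# x k i+j∼k)))
      where
      i+j∼k : residue i ℕ.+ residue j ∼ residue k [mod suc p ]
      i+j∼k = [mod]⇒∼ _ _ ijk

module Gluing
  (p c α : ℕ) (coprime : gcd α (suc (suc c)) ≡ 1)
  {S : Pred ℕ 0ℓ} (0∈S : 0 ∈ S) (S+S⊆S : ∀ {s t} → s ∈ S → t ∈ S → (s ℕ.+ t) ∈ S)
  (S+m⊆S : ∀ {s} → s ∈ S → ∀ q → (s ℕ.+ q * suc p) ∈ S) (α∈S : α ∈ S)
  where

  m β M p′ : ℕ
  m = suc p
  β = suc (suc c)
  M = β * m
  p′ = ℕ.pred M

  T : Pred ℕ 0ℓ
  T = gluing α β S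

  -- Every residue modulo M is node i j for a unique j < β and a unique i modulo m.
  node : ℕ → ℕ → ℕ
  node i j = j * α ℕ.+ β * i

  open +-*-Solver

  node-+ : ∀ i i′ j j′ → node i j ℕ.+ node i′ j′ ≡ node (i ℕ.+ i′) (j ℕ.+ j′)
  node-+ i i′ j j′ = solve 6 (λ i i′ j j′ α β →
    (j :* α :+ β :* i) :+ (j′ :* α :+ β :* i′) := (j :+ j′) :* α :+ β :* (i :+ i′)) refl i i′ j j′ α β

  -- `β` copies of `α` amount to `βα`, so a carry out of `j` raises `i` by `α`.
  node-carry : ∀ i l → node i (β ℕ.+ l) ≡ node (i ℕ.+ α) l
  node-carry i l = solve 4 (λ i l α β → (β :+ l) :* α :+ β :* i := l :* α :+ β :* (i :+ α)) refl i l α β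

  node-∼ : ∀ {i i′} j → i ∼ i′ [mod m ] → node i j ∼ node i′ j [mod M ]
  node-∼ j e = ∼-+ (∼-refl {a = j * α}) (scale-∼ β e)

  α⁻¹ : ℕ
  α⁻¹ = proj₁ (inverse-mod α (suc c) coprime)

  αα⁻¹ : ∀ n → (n * α⁻¹) * α ∼ n [mod β ]
  αα⁻¹ n = ∼-trans (≡⇒∼ (solve 3 (λ n s α → (n :* s) :* α := n :* (α :* s)) refl n α⁻¹ α))
    (∼-trans (∼-*ˡ n (proj₂ (inverse-mod α (suc c) coprime))) (≡⇒∼ (ℕ.*-identityʳ n)))

  node∼j*α : ∀ i j → node i j ∼ j * α [mod β ]
  node∼j*α i j = 0 , i , trans (ℕ.+-identityʳ _) (cong (j * α ℕ.+_) (ℕ.*-comm β i))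

  -- Modulo `β` a node reduces to `jα`, from which `α⁻¹` recovers `j`. Once the `j` agree, `βi` is
  -- known modulo `βm`, hence `i` modulo `m`.
  node-injective : ∀ {i i′ j j′} → node i j ∼ node i′ j′ [mod M ] → j < β → j′ < β →
                   j ≡ j′ × i ∼ i′ [mod m ]
  node-injective {i} {i′} {j} {j′} e j<β j′<β = j≡j′ , unscale-∼ β (∼-cancelʳ (j * α)
      (∼-trans (≡⇒∼ (ℕ.+-comm (β * i) (j * α)))
        (∼-trans e (≡⇒∼ (trans (cong (λ j → node i′ j) (sym j≡j′)) (ℕ.+-comm (j * α) (β * i′)))))))
    where
    recover : ∀ j → (j * α) * α⁻¹ ∼ j [mod β ]
    recover j = ∼-trans (≡⇒∼ (solve 3 (λ j α s → (j :* α) :* s := (j :* s) :* α) refl j α α⁻¹)) (αα⁻¹ j)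
    ∼-*ʳ : ∀ {a b} → a ∼ b [mod β ] → a * α⁻¹ ∼ b * α⁻¹ [mod β ]
    ∼-*ʳ {a} {b} e = subst₂ (_∼_[mod β ]) (ℕ.*-comm α⁻¹ a) (ℕ.*-comm α⁻¹ b) (∼-*ˡ α⁻¹ e)
    j≡j′ : j ≡ j′
    j≡j′ = ∼∧<⇒≡ (∼-trans (∼-sym (recover j)) (∼-trans (∼-*ʳ (∼-trans (∼-sym (node∼j*α i j))
      (∼-trans (∼-weaken β {m} e) (node∼j*α i′ j′)))) (recover j′))) j<β j′<β

  opaque

    decompose : ∀ n → ∃[ i ] ∃[ j ] (j < β × n ∼ node i j [mod M ])
    decompose n = i , j , ℕ.m%n<n (n * α⁻¹) β , ∼-sym (∼-trans (≡⇒∼ eq) (+*∼ n (j * α)))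
      where
      j : ℕ
      j = (n * α⁻¹) ℕ.% β
      jα∼n : j * α ∼ n [mod β ]
      jα∼n = ∼-trans (subst₂ (_∼_[mod β ]) (ℕ.*-comm α j) (ℕ.*-comm α (n * α⁻¹)) (∼-*ˡ α (%∼ (n * α⁻¹)))) (αα⁻¹ n)
      shift : ∀ n k → n ℕ.+ k * p′ ℕ.+ k ≡ n ℕ.+ k * M
      shift n k = solve 3 (λ n k q → n :+ k :* q :+ k := n :+ k :* (con 1 :+ q)) refl n k p′
      -- `n + jα(M - 1)` replaces `n - jα`, to which it is congruent modulo `M` and which might be
      -- negative.
      ∼0 : n ℕ.+ (j * α) * p′ ∼ 0 [mod β ]
      ∼0 = ∼-cancelʳ (j * α) (∼-trans (≡⇒∼ (shift n (j * α)))
        (∼-trans (∼-weaken β {m} (+*∼ n (j * α))) (∼-sym jα∼n)))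
      β∣ : β ℕ.∣ n ℕ.+ (j * α) * p′
      β∣ = ∼∧≤⇒∣ (∼-sym ∼0) ℕ.z≤n
      i : ℕ
      i = ℕ.quotient β∣
      eq : node i j ≡ n ℕ.+ (j * α) * M
      eq = trans (cong (j * α ℕ.+_) (trans (ℕ.*-comm β i) (sym (ℕ._∣_.equality β∣))))
        (trans (ℕ.+-comm (j * α) _) (shift n (j * α)))

  S+α⊆S : ∀ {s} → s ∈ S → ∀ q → (s ℕ.+ q * α) ∈ S
  S+α⊆S s∈S zero    = subst (_∈ S) (sym (ℕ.+-identityʳ _)) s∈S
  S+α⊆S {s} s∈S (suc q) = subst (_∈ S) (ℕ.+-assoc s α (q * α)) (S+α⊆S (S+S⊆S s∈S α∈S) q)

  0∈T : 0 ∈ T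
  0∈T = 0 , 0 , 0∈S , sym (ℕ.*-zeroʳ β)

  T+M⊆T : ∀ {t} → t ∈ T → ∀ q → (t ℕ.+ q * M) ∈ T
  T+M⊆T {t} (d , s , s∈S , e) q = d , s ℕ.+ q * m , S+m⊆S s∈S q , trans (cong (ℕ._+ q * M) e)
    (solve 6 (λ d α β s q m → d :* α :+ β :* s :+ q :* (β :* m) := d :* α :+ β :* (s :+ q :* m)) refl d α β s q m)

  module _ {a : Vector ℕ p} (apery : AperyFunction S m (periodic 0 a))
           {b : Vector ℕ p′} (apery′ : AperyFunction T M (periodic 0 b)) where

    private
      module S = AperyFunction apery
      module T′ = AperyFunction apery′

    â b̂ : ℕ → ℕ
    â = periodic 0 a
    b̂ = periodic 0 b

    â0≡0 : â 0 ≡ 0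
    â0≡0 = periodic-0 0 a ∼-refl

    -- In an element `dα + βs` of `T`, every `β` copies of `α` can be moved into `s`, because `α`
    -- lies in `S`. What remains is `jα + βs′` with `j < β` and `s′` in the class of `i`, and `s′`
    -- is at least `â i`.
    b̂-node : ∀ {n} i j → j < β → n ∼ node i j [mod M ] → b̂ n ≡ node (â i) j
    b̂-node i j j<β n∼ = trans (T′.respects n∼)
      (T′.unique (j , â i , S.member i , refl) (node-∼ j (S.congruent i)) node-least)
      where
      node-least : ∀ {t} → t ∈ T → t ∼ node i j [mod M ] → node (â i) j ≤ t
      node-least {t} (d , s , s∈S , t≡) t∼ =
        let q = d ℕ./ β
            r = d ℕ.% β
            t≡node : t ≡ node (s ℕ.+ q * α) r
            t≡node = trans t≡ (trans (cong (λ d → d * α ℕ.+ β * s) (ℕ.m≡m%n+[m/n]*n d β))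
              (solve 5 (λ r q β α s → (r :+ q :* β) :* α :+ β :* s := r :* α :+ β :* (s :+ q :* α)) refl r q β α s))
            r≡j , s+qα∼i = node-injective (∼-trans (≡⇒∼ (sym t≡node)) t∼) (ℕ.m%n<n d β) j<β
        in ℕ.≤-trans (ℕ.+-mono-≤ (ℕ.≤-reflexive (cong (_* α) (sym r≡j)))
             (ℕ.*-monoʳ-≤ β (S.least (S+α⊆S s∈S q) s+qα∼i))) (ℕ.≤-reflexive (sym t≡node))

    -- The tight hyperplanes at b in the coordinates z = y_α and x_i = y_{βi};
    -- the multiple β α of α is the only source of a relation involving z.
    Glued : Pred (Vector ℝ (suc p)) 0ℓ
    Glued w = tail w ∈ Tight m a × (α ≡ â α → β · head w ≈ periodic 0# (tail w) α)

    1<β : 1 < β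
    1<β = ℕ.s≤s (ℕ.s≤s ℕ.z≤n)

    α∼node : α ∼ node 0 1 [mod M ]
    α∼node = ≡⇒∼ (solve 2 (λ α β → α := con 1 :* α :+ β :* con 0) refl α β)

    b̂α≡α : b̂ α ≡ α
    b̂α≡α = trans (b̂-node 0 1 1<β α∼node) (trans (cong (λ n → node n 1) â0≡0)
      (solve 2 (λ α β → con 1 :* α :+ β :* con 0 := α) refl α β))

    b̂β : ∀ i → b̂ (β * i) ≡ β * â i
    b̂β i = b̂-node i 0 (ℕ.s≤s ℕ.z≤n) ∼-refl

    module _ {y} (tight : y ∈ Tight M b) where

      private
        ŷ : ℕ → ℝ
        ŷ = periodic 0# y
        tight-ŷ : y ∈ TightPeriodic b
        tight-ŷ = Tight⇒TightPeriodic apery′ tight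

      -- While `j` stays below `β`, each further `α` raises the Apéry element of the node by exactly
      -- `α = b̂ α`, which is a tight relation. Thus `z` and `x` determine `y` at every residue.
      ŷ-node : ∀ i j → j < β → ŷ (node i j) ≈ ŷ (β * i) R.+ j · ŷ α
      ŷ-node i zero    _   = ≈-sym (+-identityʳ _)
      ŷ-node i (suc j) j<β = begin
        ŷ (node i (suc j))                    ≡⟨ cong ŷ (ℕ.+-assoc α (j * α) (β * i)) ⟩
        ŷ (α ℕ.+ node i j)                    ≈⟨ tight-ŷ α (node i j) tight-sum ⟨
        ŷ α R.+ ŷ (node i j)                  ≈⟨ +-congˡ (ŷ-node i j j<β′) ⟩
        ŷ α R.+ (ŷ (β * i) R.+ j · ŷ α)
          ≈⟨ x∙yz≈y∙xz (ŷ α) (ŷ (β * i)) (j · ŷ α) ⟩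
        ŷ (β * i) R.+ (ŷ α R.+ j · ŷ α)       ∎
        where
        open SetoidReasoning setoid
        j<β′ : j < β
        j<β′ = ℕ.<-trans (ℕ.n<1+n j) j<β
        tight-sum : b̂ α ℕ.+ b̂ (node i j) ≡ b̂ (α ℕ.+ node i j)
        tight-sum = trans (cong₂ ℕ._+_ b̂α≡α (b̂-node i j j<β′ ∼-refl))
          (trans (sym (ℕ.+-assoc α (j * α) (β * â i)))
            (sym (b̂-node i (suc j) j<β (≡⇒∼ (sym (ℕ.+-assoc α (j * α) (β * i)))))))

    to : Vector ℝ p′ → Vector ℝ (suc p)
    to y = periodic 0# y α ∷ λ i → periodic 0# y (β * residue i)

    periodic-tail-to : ∀ y n → periodic {p} 0# (tail (to y)) n ≈ periodic 0# y (β * n)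
    periodic-tail-to y = periodic-tabulate (λ n → periodic 0# y (β * n))
      (λ e → ≡⇒≈ (periodic-cong 0# y (scale-∼ β e)))
      (≡⇒≈ (periodic-0 0# y (≡⇒∼ (ℕ.*-zeroʳ β))))

    I J : ℕ → ℕ
    I n = proj₁ (decompose n)
    J n = proj₁ (proj₂ (decompose n))

    J<β : ∀ n → J n < β
    J<β n = proj₁ (proj₂ (proj₂ (decompose n)))

    ∼node : ∀ n → n ∼ node (I n) (J n) [mod M ]
    ∼node n = proj₂ (proj₂ (proj₂ (decompose n)))

    -- The formula of `ŷ-node`, read as a definition of `y` from `z` and `x`.
    value : Vector ℝ (suc p) → ℕ → ℝ
    value w n = periodic 0# (tail w) (I n) R.+ J n · head w

    from : Vector ℝ (suc p) → Vector ℝ p′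
    from w r = value w (residue r)

    value-node : ∀ w {n} i j → j < β → n ∼ node i j [mod M ] →
                 value w n ≈ periodic 0# (tail w) i R.+ j · head w
    value-node w {n} i j j<β e =
      let J≡j , I∼i = node-injective (∼-trans (∼-sym (∼node n)) e) (J<β n) j<β
      in +-cong (≡⇒≈ (periodic-cong 0# (tail w) I∼i)) (≡⇒≈ (cong (_· head w) J≡j))

    periodic-from : ∀ w {n} i j → j < β → n ∼ node i j [mod M ] →
                    periodic 0# (from w) n ≈ periodic 0# (tail w) i R.+ j · head w
    periodic-from w {n} i j j<β e = ≈-trans
      (periodic-tabulate (value w)
        (λ {k} {l} k∼l → value-node w (I l) (J l) (J<β l) (∼-trans k∼l (∼node l)))
        (≈-trans (value-node w 0 0 (ℕ.s≤s ℕ.z≤n) (≡⇒∼ (sym (ℕ.*-zeroʳ β))))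
          (≈-trans (+-identityʳ _) (≡⇒≈ (periodic-0 0# (tail w) ∼-refl)))) n)
      (value-node w i j j<β e)

    to-∈ : ∀ {y} → y ∈ Tight M b → to y ∈ Glued
    to-∈ {y} tight = TightPeriodic⇒Tight apery tail-tight , relation
      where
      open SetoidReasoning setoid
      ŷ : ℕ → ℝ
      ŷ = periodic 0# y
      tight-ŷ = Tight⇒TightPeriodic apery′ tight
      tail-tight : tail (to y) ∈ TightPeriodic a
      tail-tight k l e = begin
        _ ≈⟨ +-cong (periodic-tail-to y k) (periodic-tail-to y l) ⟩
        ŷ (β * k) R.+ ŷ (β * l)   ≈⟨ tight-ŷ (β * k) (β * l) tight-sum ⟩
        ŷ (β * k ℕ.+ β * l)       ≡⟨ cong ŷ (ℕ.*-distribˡ-+ β k l) ⟨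
        ŷ (β * (k ℕ.+ l))         ≈⟨ periodic-tail-to y (k ℕ.+ l) ⟨
        _ ∎
        where
        tight-sum : b̂ (β * k) ℕ.+ b̂ (β * l) ≡ b̂ (β * k ℕ.+ β * l)
        tight-sum = trans (cong₂ ℕ._+_ (b̂β k) (b̂β l)) (trans (sym (ℕ.*-distribˡ-+ β (â k) (â l)))
          (trans (cong (β *_) e) (trans (sym (b̂β (k ℕ.+ l))) (cong b̂ (ℕ.*-distribˡ-+ β k l)))))
      -- `ŷ-node` reaches only `j = β - 1`, which is `suc c`. The last `α` has to be added by a
      -- relation of its own, and this one is tight because `α ≡ â α`.
      relation : α ≡ â α → β · ŷ α ≈ periodic 0# (tail (to y)) α
      relation α≡âα = begin
        ŷ α R.+ suc c · ŷ α               ≈⟨ +-congˡ (+-identityˡ _) ⟨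
        ŷ α R.+ (0# R.+ suc c · ŷ α)
          ≡⟨ cong (λ z → ŷ α R.+ (z R.+ suc c · ŷ α)) (periodic-0 0# y (≡⇒∼ (ℕ.*-zeroʳ β))) ⟨
        ŷ α R.+ (ŷ (β * 0) R.+ suc c · ŷ α)   ≈⟨ +-congˡ (ŷ-node tight 0 (suc c) (ℕ.n<1+n _)) ⟨
        ŷ α R.+ ŷ (node 0 (suc c))        ≈⟨ tight-ŷ α (node 0 (suc c)) tight-sum ⟩
        ŷ (α ℕ.+ node 0 (suc c))          ≡⟨ cong ŷ βα ⟩
        ŷ (β * α)                         ≈⟨ periodic-tail-to y α ⟨
        _                                 ∎
        where
        βα : α ℕ.+ node 0 (suc c) ≡ β * α
        βα = solve 2 (λ α c → α :+ ((con 1 :+ c) :* α :+ (con 2 :+ c) :* con 0) := (con 2 :+ c) :* α) refl α c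
        tight-sum : b̂ α ℕ.+ b̂ (node 0 (suc c)) ≡ b̂ (α ℕ.+ node 0 (suc c))
        tight-sum = trans
          (cong₂ ℕ._+_ b̂α≡α (trans (b̂-node 0 (suc c) (ℕ.n<1+n _) ∼-refl)
            (cong (λ n → node n (suc c)) â0≡0)))
          (trans βα (trans (cong (β *_) α≡âα) (trans (sym (b̂β α)) (cong b̂ (sym βα)))))

    module _ {w} (w∈Glued : w ∈ Glued) where

      private
        x̂ : ℕ → ℝ
        x̂ = periodic 0# (tail w)
        z = head w
        tight-x̂ : tail w ∈ TightPeriodic a
        tight-x̂ = Tight⇒TightPeriodic apery (proj₁ w∈Glued)

      -- The multiples of `α` cancel, and dividing by `β` leaves a relation of `S`.
      no-carry : ∀ i i′ j j′ → node (â i) j ℕ.+ node (â i′) j′ ≡ node (â (i ℕ.+ i′)) (j ℕ.+ j′) →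
        (x̂ i R.+ j · z) R.+ (x̂ i′ R.+ j′ · z) ≈ x̂ (i ℕ.+ i′) R.+ (j ℕ.+ j′) · z
      no-carry i i′ j j′ e = ≈-trans
        (interchange (x̂ i) (j · z) (x̂ i′) (j′ · z))
        (+-cong (tight-x̂ i i′ (ℕ.*-cancelˡ-≡ _ _ β (ℕ.+-cancelˡ-≡ ((j ℕ.+ j′) * α) _ _
            (trans (sym (node-+ (â i) (â i′) j j′)) e))))
          (≈-sym (·-homo-+ z j j′)))

      -- Removing `lα` and dividing by `β` turns the hypothesis into
      -- `â i + â i′ + α = â (i + i′ + α)`. By subadditivity the right side is at most
      -- `â i + â i′ + â α`, and `â α ≤ α`. So every inequality in this chain is an equality, which
      -- gives `α = â α` and two tight relations of `S`.
      carry : ∀ i i′ j j′ l → j ℕ.+ j′ ≡ β ℕ.+ l →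
        node (â i) j ℕ.+ node (â i′) j′ ≡ node (â (i ℕ.+ i′ ℕ.+ α)) l →
        (x̂ i R.+ j · z) R.+ (x̂ i′ R.+ j′ · z) ≈ x̂ (i ℕ.+ i′ ℕ.+ α) R.+ l · z
      carry i i′ j j′ l j+j′ e = begin
        (x̂ i R.+ j · z) R.+ (x̂ i′ R.+ j′ · z)
          ≈⟨ interchange (x̂ i) (j · z) (x̂ i′) (j′ · z) ⟩
        (x̂ i R.+ x̂ i′) R.+ (j · z R.+ j′ · z)
          ≈⟨ +-cong (tight-x̂ i i′ âi+âi′) (≈-trans (≈-sym (·-homo-+ z j j′)) (≡⇒≈ (cong (_· z) j+j′))) ⟩
        x̂ (i ℕ.+ i′) R.+ (β ℕ.+ l) · z
          ≈⟨ +-congˡ (≈-trans (·-homo-+ z β l) (+-congʳ _ (proj₂ w∈Glued α≡âα))) ⟩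
        x̂ (i ℕ.+ i′) R.+ (x̂ α R.+ l · z)      ≈⟨ +-assoc _ _ _ ⟨
        (x̂ (i ℕ.+ i′) R.+ x̂ α) R.+ l · z      ≈⟨ +-congʳ _ (tight-x̂ (i ℕ.+ i′) α âi+i′+âα) ⟩
        x̂ (i ℕ.+ i′ ℕ.+ α) R.+ l · z          ∎
        where
        open SetoidReasoning setoid
        sum≡ : â i ℕ.+ â i′ ℕ.+ α ≡ â (i ℕ.+ i′ ℕ.+ α)
        sum≡ = ℕ.*-cancelˡ-≡ _ _ β (ℕ.+-cancelˡ-≡ (l * α) _ _
          (trans (sym (node-carry (â i ℕ.+ â i′) l)) (trans (cong (node (â i ℕ.+ â i′)) (sym j+j′))
            (trans (sym (node-+ (â i) (â i′) j j′)) e))))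
        âα≤α : â α ≤ α
        âα≤α = S.least α∈S ∼-refl
        subadd : ∀ k l → â (k ℕ.+ l) ≤ â k ℕ.+ â l
        subadd = S.subadditive S+S⊆S
        α≡âα : α ≡ â α
        α≡âα = ℕ.≤-antisym (ℕ.+-cancelˡ-≤ (â i ℕ.+ â i′) _ _ (ℕ.≤-trans (ℕ.≤-reflexive sum≡)
          (ℕ.≤-trans (subadd (i ℕ.+ i′) α) (ℕ.+-monoˡ-≤ (â α) (subadd i i′))))) âα≤α
        âi+âi′ : â i ℕ.+ â i′ ≡ â (i ℕ.+ i′)
        âi+âi′ = ℕ.≤-antisym (ℕ.+-cancelʳ-≤ α _ _ (ℕ.≤-trans (ℕ.≤-reflexive sum≡)
          (ℕ.≤-trans (subadd (i ℕ.+ i′) α) (ℕ.+-monoʳ-≤ (â (i ℕ.+ i′)) âα≤α)))) (subadd i i′)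
        âi+i′+âα : â (i ℕ.+ i′) ℕ.+ â α ≡ â (i ℕ.+ i′ ℕ.+ α)
        âi+i′+âα = trans (cong₂ ℕ._+_ (sym âi+âi′) (sym α≡âα)) sum≡

      from-tight : from w ∈ TightPeriodic b
      from-tight n n′ e with J n ℕ.+ J n′ ℕ.<? β
      ... | yes j+j′<β = ≈-trans
            (+-cong (periodic-from w (I n) (J n) (J<β n) (∼node n))
                    (periodic-from w (I n′) (J n′) (J<β n′) (∼node n′)))
            (≈-trans (no-carry (I n) (I n′) (J n) (J n′) (trans
                (cong₂ ℕ._+_ (sym (b̂-node _ _ (J<β n) (∼node n))) (sym (b̂-node _ _ (J<β n′) (∼node n′))))
                (trans e (b̂-node _ _ j+j′<β n+n′∼))))
              (≈-sym (periodic-from w _ _ j+j′<β n+n′∼)))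
        where
        n+n′∼ : n ℕ.+ n′ ∼ node (I n ℕ.+ I n′) (J n ℕ.+ J n′) [mod M ]
        n+n′∼ = ∼-trans (∼-+ (∼node n) (∼node n′)) (≡⇒∼ (node-+ (I n) (I n′) (J n) (J n′)))
      ... | no j+j′≮β = ≈-trans
            (+-cong (periodic-from w (I n) (J n) (J<β n) (∼node n))
                    (periodic-from w (I n′) (J n′) (J<β n′) (∼node n′)))
            (≈-trans (carry (I n) (I n′) (J n) (J n′) l (sym β+l) (trans
                (cong₂ ℕ._+_ (sym (b̂-node _ _ (J<β n) (∼node n))) (sym (b̂-node _ _ (J<β n′) (∼node n′))))
                (trans e (b̂-node _ _ l<β n+n′∼))))
              (≈-sym (periodic-from w _ _ l<β n+n′∼)))
        where
        l = J n ℕ.+ J n′ ℕ.∸ β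
        β+l : β ℕ.+ l ≡ J n ℕ.+ J n′
        β+l = ℕ.m+[n∸m]≡n (ℕ.≮⇒≥ j+j′≮β)
        -- Both summands are below `β`, so one carry is enough.
        l<β : l < β
        l<β = ℕ.+-cancelˡ-< β l β (subst (_< β ℕ.+ β) (sym β+l) (ℕ.+-mono-< (J<β n) (J<β n′)))
        n+n′∼ : n ℕ.+ n′ ∼ node (I n ℕ.+ I n′ ℕ.+ α) l [mod M ]
        n+n′∼ = ∼-trans (∼-+ (∼node n) (∼node n′)) (≡⇒∼ (trans (node-+ (I n) (I n′) (J n) (J n′))
          (trans (cong (node (I n ℕ.+ I n′)) (sym β+l)) (node-carry (I n ℕ.+ I n′) l))))

    Tight≅Glued : Tight M b ≅ Glued
    Tight≅Glued = record
      { to = to ; from = from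
      ; to-linear = λ { zero → periodic-linear α ; (suc i) → periodic-linear (β * residue i) }
      ; from-linear = λ r → +-linear
          (∘-linear (periodic-linear (I (residue r))) (λ i → coordinate-linear (suc i)))
          (·-linear (J (residue r)) (coordinate-linear zero))
      ; to-∈ = to-∈
      ; from-∈ = λ {w} w∈Glued → TightPeriodic⇒Tight apery′ (from-tight {w} w∈Glued)
      ; from-to = λ {y} tight r → from-to y tight (residue r) r ∼-refl
      -- `α` is the node with `i = 0` and `j = 1`; as `1 < β`, the coefficient of `z` there is 1.
      -- The other coordinates are read off at nodes with `j = 0`.
      ; to-from = λ { {w} _ zero → ≈-trans (periodic-from w 0 1 1<β α∼node)
                        (≈-trans (+-cong (≡⇒≈ (periodic-0 0# (tail w) ∼-refl)) (+-identityʳ (head w))) (+-identityˡ _))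
                    ; {w} _ (suc i) → ≈-trans (periodic-from w (residue i) 0 (ℕ.s≤s ℕ.z≤n) ∼-refl)
                        (≈-trans (+-identityʳ _) (≡⇒≈ (periodic-residue 0# (tail w) i ∼-refl))) } }
      where
      from-to : ∀ y → y ∈ Tight M b → ∀ n r → n ∼ residue r [mod M ] → value (to y) n ≈ y r
      from-to y tight n r n∼r = begin
        value (to y) n
          ≈⟨ +-congʳ _ (periodic-tail-to y (I n)) ⟩
        periodic 0# y (β * I n) R.+ J n · periodic 0# y α   ≈⟨ ŷ-node tight (I n) (J n) (J<β n) ⟨
        periodic 0# y (node (I n) (J n))
          ≡⟨ periodic-residue 0# y r (∼-trans (∼-sym (∼node n)) n∼r) ⟩
        y r                                                 ∎
        where open SetoidReasoning setoid

    Glued≅Tight : α ≡ â α → Glued ≅ Tight m a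
    -- `z` is recovered as `x_α / β`; since `·-inverse n` divides by `n + 1`, its argument is
    -- `β - 1`.
    Glued≅Tight α≡âα = let γ , inverse = ·-inverse (suc c) in record
      { to = tail ; from = λ x → (γ R.* periodic 0# x α) ∷ x
      ; to-linear = λ i → coordinate-linear (suc i)
      ; from-linear = λ { zero → *-linear γ (periodic-linear α) ; (suc i) → coordinate-linear i }
      ; to-∈ = proj₁
      ; from-∈ = λ tight → tight , λ _ → proj₁ (inverse _)
      ; from-to = λ { {w} (_ , relation) zero → ≈-trans (*-congˡ (≈-sym (relation α≡âα))) (proj₂ (inverse (head w)))
                    ; _ (suc i) → ≈-refl }
      ; to-from = λ _ _ → ≈-refl }

    -- The condition on `z` is vacuous here, so `z` is free.
    Glued≅Cylinder : α ≢ â α → Glued ≅ Cylinder (Tight m a)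
    Glued≅Cylinder α≢âα = ⇔⇒≅ proj₁ (λ tight → tight , λ α≡âα → contradiction α≡âα α≢âα)

-- The theorem for a semigroup given by generators

⟨⟩-+* : ∀ {k} m (ns : Vector ℕ k) {s} → s ∈ ⟨ m ∷ ns ⟩ → ∀ q → (s ℕ.+ q * m) ∈ ⟨ m ∷ ns ⟩
⟨⟩-+* m ns {s} (c , e) q = ((head c ℕ.+ q) ∷ tail c) , trans (cong (ℕ._+ q * m) e)
  (solve 4 (λ c q m r → c :* m :+ r :+ q :* m := (c :+ q) :* m :+ r) refl (head c) q m
    (RawMonoid.sum ℕ.+-0-rawMonoid (λ i → tail c i * ns i)))
  where open +-*-Solver

corollary6p12 : ∀ {k} (m : ℕ) (ns : Vector ℕ k) (α β : ℕ)
    (F : Pred (Point m) 0ℓ) (F′ : Pred (Point (β * m)) 0ℓ) →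
    0 < m →
    IsNumericalSemigroup ⟨ m ∷ ns ⟩ →
    2 ≤ β →
    α ∈ ⟨ m ∷ ns ⟩ →
    (∀ i → α ≢ (m ∷ ns) i) →
    gcd α β ≡ 1 →
    IsFace m F →
    Contains m F ⟨ m ∷ ns ⟩ →
    IsFace (β * m) F′ →
    Contains (β * m) F′ (gluing α β ⟨ m ∷ ns ⟩) →
    ∃[ d ] (HasDim F d ×
    (α ∈ Ap ⟨ m ∷ ns ⟩ m → HasDim F′ d) ×
    (α ∉ Ap ⟨ m ∷ ns ⟩ m → HasDim F′ (suc d)))
corollary6p12 zero _ _ _ _ _ ()
corollary6p12 (suc p) _ _ (suc zero) _ _ _ _ (ℕ.s≤s ())
corollary6p12 (suc p) ns α (suc (suc c)) F F′ 0<m S-semigroup _ α∈S _ coprime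
  isFace (a , aTuple , a∈relint) isFace′ (b , bTuple , b∈relint) =
    d
  , HasDim-≅ F (≅-trans (affineSpan≅Tight isFace a∈relint) Tight≅ℝᵈ′)
  , (λ α∈Ap → HasDim-≅ F′ (≅-trans span′ (≅-trans (Glued≅Tight apery apery′ (proj₁ α∈Ap⇔ α∈Ap)) Tight≅ℝᵈ′)))
  , (λ α∉Ap → HasDim-≅ F′ (≅-trans span′ (≅-trans (Glued≅Cylinder apery apery′ (λ e → α∉Ap (proj₂ α∈Ap⇔ e)))
      (Cylinder-≅ Tight≅ℝᵈ′))))
  where
  open IsNumericalSemigroup S-semigroup
  open Gluing p c α coprime {⟨ suc p ∷ ns ⟩} 0∈ +-closed (⟨⟩-+* (suc p) ns) α∈S
  apery  = IsAperyTuple⇒AperyFunction 0∈ (⟨⟩-+* (suc p) ns) aTuple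
  apery′ = IsAperyTuple⇒AperyFunction 0∈T T+M⊆T bTuple
  α∈Ap⇔ = AperyFunction.Ap⇔ apery 0<m (⟨⟩-+* (suc p) ns) α∈S
  d = proj₁ (Tight≅ℝᵈ (suc p) a)
  Tight≅ℝᵈ′ : Tight (suc p) a ≅ Everything d
  Tight≅ℝᵈ′ = proj₂ (Tight≅ℝᵈ (suc p) a)
  span′ : AffineSpan F′ ≅ Glued apery apery′
  span′ = ≅-trans (affineSpan≅Tight isFace′ b∈relint) (Tight≅Glued apery apery′)
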